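{- Let $\mu$ be a given partition and $r$ a nonnegative integer. Then $$\sum_{|\lambda/\mu|=n}f_{\lambda/\mu}\frac{L_r(\lambda)}{H_\lambda}=\sum_{0\le k\le 2r}\binom{n}{k}D^k\Bigl(\frac{L_r(\mu)}{H_\mu}\Bigr)$$ is a polynomial in $n$ of degree at most $2r$. In particular, $\sum_{|\lambda|=n}f_\lambda\frac{L_r(\lambda)}{H_\lambda}=\sum_{0\le k\le 2r}d_k\binom{n}{k}$, where $d_k=D^k\bigl(L_r(\lambda)/H_\lambda\bigr)\big|_{\lambda=\emptyset}$.
   Context: The sum over $|\lambda/\mu|=n$ ranges over partitions $\lambda\supseteq\mu$ with $|\lambda|-|\mu|=n$; $f_{\lambda/\mu}$ is the number of standard Young tableaux of skew shape $\lambda/\mu$ and $f_\lambda=f_{\lambda/\emptyset}$. $h_\square$ is the hook length (arm + leg + 1), $H_\lambda=\prod_{\square\in\lambda}h_\square$, $H_\emptyset=1$. For a positive integer $h$, $\rho(h,z)=\frac{h\sum_{k\ge0}\binom{h}{2k}z^k}{\sum_{k\ge0}\binom{h}{2k+1}z^k}$ as a formal power series in $z$, and $L_k(\lambda)$ is defined by $\prod_{\square\in\lambda}\rho(h_\square,z)=\sum_{k\ge0}L_k(\lambda)z^k$. For a function $g$ on partitions, $Dg(\lambda)=\sum_{\lambda^+}g(\lambda^+)-g(\lambda)$, where $\lambda^+$ ranges over partitions obtained from $\lambda$ by adding one box; $D^0g=g$, $D^kg=D(D^{k-1}g)$; $D^k(L_r(\mu)/H_\mu)$ means $D^k$ of $\lambda\mapsto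 L_r(\lambda)/H_\lambda$ evaluated at $\mu$. -}

module Defs where

open import Data.Bool using (Bool; true; false; _∧_)
open import Data.Nat as ℕ using (ℕ; zero; suc; _∸_; _≤_; _<_; _≤?_; _<?_; _≤ᵇ_; _<ᵇ_)
open import Data.Nat.Combinatorics using (_C_)
open import Data.Integer using (+_)
open import Data.Rational as ℚ using (ℚ; 0ℚ; 1ℚ; _/_)
open import Data.Nat.ListAction using (sum; product)
open import Data.List using (List; []; _∷_; [_]; map; filter; filterᵇ; length;
  concat; concatMap; zipWith; upTo; applyUpTo; reverse; _++_; foldr)
open import Data.List.Properties using (≡-dec)
open import Data.Product using (_×_; _,_)
open import Relation.Nullary using (yes; no)
open import Relation.Binary.PropositionalEquality using (_≡_)

data IsPartition : List ℕ → Set where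
  nil  : IsPartition []
  one  : ∀ {x} → 1 ≤ x → IsPartition (x ∷ [])
  cons : ∀ {x y ys} → y ≤ x → IsPartition (y ∷ ys) → IsPartition (x ∷ y ∷ ys)

part : List ℕ → ℕ → ℕ
part []       _       = 0
part (x ∷ xs) zero    = x
part (x ∷ xs) (suc i) = part xs i

size : List ℕ → ℕ
size = sum

headOr0 : List ℕ → ℕ
headOr0 []      = 0
headOr0 (x ∷ _) = x

addOne : List ℕ → List (List ℕ)
addOne []       = [ 1 ∷ [] ]
addOne (x ∷ xs) =
  (suc x ∷ xs) ∷ map (x ∷_) (filter (λ ys → headOr0 ys ≤? x) (addOne xs))

contains : List ℕ → List ℕ → Bool
contains lam       []       = true
contains []        (m ∷ ms) = false
contains (l ∷ ls)  (m ∷ ms) = (m ≤ᵇ l) ∧ contains ls ms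

-- all partitions of m with all parts ≤ b (fuel argument ≥ m)
partsBounded : (fuel m b : ℕ) → List (List ℕ)
partsBounded zero       _       _ = [ [] ]
partsBounded (suc f)    zero    _ = [ [] ]
partsBounded (suc f) (suc m)    b =
  concatMap (λ p → map (p ∷_) (partsBounded f (suc m ∸ p) p))
            (applyUpTo suc (ℕ._⊓_ (suc m) b))

partitionsOf : ℕ → List (List ℕ)
partitionsOf m = partsBounded m m m

skewShapes : List ℕ → ℕ → List (List ℕ)
skewShapes mu n = filterᵇ (λ lam → contains lam mu) (partitionsOf (size mu ℕ.+ n))

-- f_{λ/μ}: number of standard Young tableaux of shape λ/μ.  A standard
-- Young tableau of shape λ/μ with n cells is the same datum as a chain
-- μ = λ⁰ ⊂ λ¹ ⊂ … ⊂ λⁿ = λ in which each step adds one box (the box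
-- containing entry i is λⁱ/λⁱ⁻¹); we count these chains.

chains : ℕ → List ℕ → List ℕ → ℕ
chains zero    mu lam with ≡-dec ℕ._≟_ mu lam
... | yes _ = 1
... | no  _ = 0
chains (suc n) mu lam = sum (map (λ nu → chains n nu lam) (addOne mu))

fSkew : List ℕ → List ℕ → ℕ
fSkew lam mu = chains (size lam ∸ size mu) mu lam

f : List ℕ → ℕ
f lam = fSkew lam []

conj : List ℕ → ℕ → ℕ
conj lam j = length (filter (λ x → j <? x) lam)

cells : List ℕ → List (ℕ × ℕ)
cells lam = concat (zipWith (λ i len → map (i ,_) (upTo len)) (upTo (length lam)) lam)

hook : List ℕ → ℕ × ℕ → ℕ
hook lam (i , j) = (part lam i ∸ suc j) ℕ.+ (conj lam j ∸ suc i) ℕ.+ 1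

H : List ℕ → ℕ
H lam = product (map (hook lam) (cells lam))

fromℕ : ℕ → ℚ
fromℕ n = + n / 1

-- 1/n for n ≥ 1 (value at 0 is irrelevant; set to 0)
recip : ℕ → ℚ
recip zero    = 0ℚ
recip (suc n) = + 1 / suc n

nth : List ℚ → ℕ → ℚ
nth []       _       = 0ℚ
nth (x ∷ xs) zero    = x
nth (x ∷ xs) (suc i) = nth xs i

sumTo : ℕ → (ℕ → ℚ) → ℚ
sumTo k g = foldr ℚ._+_ 0ℚ (map g (upTo (suc k)))

Series : Set
Series = ℕ → ℚ

oneₛ : Series
oneₛ zero    = 1ℚ
oneₛ (suc _) = 0ℚ

_*ₛ_ : Series → Series → Series
(a *ₛ b) k = sumTo k (λ i → a i ℚ.* b (k ∸ i))

numρ : ℕ → Series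
numρ h k = fromℕ (h ℕ.* (h C (2 ℕ.* k)))

denρ : ℕ → Series
denρ h k = fromℕ (h C suc (2 ℕ.* k))

-- first k+1 coefficients of numρ h / denρ h (formal power series
-- division; the constant term of the denominator is h ≥ 1):
--   q_k = (a_k − Σ_{j=1}^{k} b_j q_{k−j}) / b_0
ρList : ℕ → ℕ → List ℚ
ρList h zero    = [ numρ h 0 ℚ.* recip (h C 1) ]
ρList h (suc k) =
  qs ++ [ (numρ h (suc k) ℚ.- sumTo k (λ i → denρ h (suc i) ℚ.* nth (reverse qs) i))
          ℚ.* recip (h C 1) ]
  where qs = ρList h k

ρ : ℕ → Series
ρ h k = nth (ρList h k) k

L : ℕ → List ℕ → ℚ
L k lam = foldr _*ₛ_ oneₛ (map (λ c → ρ (hook lam c)) (cells lam)) k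

LoverH : ℕ → List ℕ → ℚ
LoverH r lam = L r lam ℚ.* recip (H lam)

D : (List ℕ → ℚ) → List ℕ → ℚ
D g lam = foldr ℚ._+_ 0ℚ (map g (addOne lam)) ℚ.- g lam

Dpow : ℕ → (List ℕ → ℚ) → List ℕ → ℚ
Dpow zero    g = g
Dpow (suc k) g = D (Dpow k g)

skewSum : List ℕ → ℕ → ℕ → ℚ
skewSum mu r n =
  foldr ℚ._+_ 0ℚ (map (λ lam → fromℕ (fSkew lam mu) ℚ.* LoverH r lam) (skewShapes mu n))

straightSum : ℕ → ℕ → ℚ
straightSum r n =
  foldr ℚ._+_ 0ℚ (map (λ lam → fromℕ (f lam) ℚ.* LoverH r lam) (partitionsOf n))

binomSum : ℕ → ℕ → (ℕ → ℚ) → ℚ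
binomSum r n c = sumTo (2 ℕ.* r) (λ k → fromℕ (n C k) ℚ.* c k)

-- Put φ(h) = ρ(h)/h, so that G(λ) = ∏ φ(h) over the hooks of λ has z^r-coefficient
-- L_r(λ)/H_λ.  With s = √z, φ(h) = s ((1+s)^h + (1-s)^h) / ((1+s)^h - (1-s)^h) is a
-- hyperbolic cotangent, and τ = 1/φ a tangent with
-- τ(a+b) (1 + z τ(a) τ(b)) = τ(a) + τ(b).
--
-- Let U and V sum a function over all ways of adding, respectively removing, a box.
-- The key identity is (U - 1) G = z V G.  In beta numbers l_i one has
-- G = ∏_{i<j} τ(l_i - l_j) ∏_i φ(1)⋯φ(l_i), and the identity becomes an evaluation
-- of a sum of residues, read off the partial fraction expansion of a product of cotangents.
--
-- Since U V - V U = 1, the operator D = U - 1 satisfies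
-- D V^j G = z V^{j+1} G + j V^{j-1} G.  Hence D^k G is divisible by z^⌈k/2⌉, so that
-- D^{2r+1} annihilates L_r/H.  The left hand side of the theorem is (1 + D)^n applied to
-- L_r/H, and the binomial expansion stops at k = 2r.

{-# OPTIONS --safe #-}
module Submission where

open import Defs
open import Data.Nat using (ℕ)
open import Data.List using (List; [])
open import Data.Product using (_×_)
open import Relation.Binary.PropositionalEquality using (_≡_)
open import Algebra.Bundles using (CommutativeRing)
import Algebra.Properties.Ring as RingProperties
import Algebra.Solver.Ring as RingSolver
open import Algebra.Solver.Ring.AlmostCommutativeRing
  using (_-Raw-AlmostCommutative⟶_; fromCommutativeRing)
open import Data.Bool.Base using (true; _∧_; T)
open import Data.Bool.Properties using (T?)
open import Data.Integer.Base as ℤ using (+_)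
import Data.Integer.Properties as ℤₚ
open import Data.List.Base using (_∷_; _∷ʳ_; _++_; applyDownFrom; applyUpTo; concat; concatMap;
  filter; foldr; length; map; reverse; upTo; zipWith)
open import Data.List.Properties using (∷-injectiveˡ; ∷-injectiveʳ; ≡-dec; applyUpTo-∷ʳ;
  filter-accept; filter-all; filter-none; length-++; length-applyUpTo; map-++; map-applyUpTo;
  map-cong-local; map-∘; reverse-applyUpTo)
open import Data.List.Relation.Unary.All as All using (All; []; _∷_)
import Data.List.Relation.Unary.All.Properties as Allₚ
open import Data.List.Relation.Unary.AllPairs using (AllPairs; []; _∷_)
open import Data.Maybe.Base as Maybe using (Maybe)
open import Data.Nat.Base as ℕ using (zero; suc; pred; _∸_; _≤_; _<_; _>_; z≤n; s≤s)
open import Data.Nat.Combinatorics using (_C_; nC1≡n; nCk+nC[k+1]≡[n+1]C[k+1])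
open import Data.Nat.ListAction using (sum; product)
import Data.Nat.Properties as ℕₚ
open import Data.Product.Base using (_,_; proj₂; map₁)
open import Data.Rational.Base as ℚ using (ℚ; 0ℚ; 1ℚ; fromℚᵘ)
import Data.Rational.Properties as ℚₚ
import Data.Rational.Solver as ℚSolver
import Data.Rational.Unnormalised.Base as ℚᵘ
import Data.Rational.Unnormalised.Properties as ℚᵘₚ
open import Data.Sum.Base using (_⊎_; inj₁; inj₂)
open import Level using (Level)
open import Relation.Binary.PropositionalEquality as ≡ using (_≢_)
import Relation.Binary.Reasoning.Setoid as SetoidReasoning
open import Relation.Nullary.Decidable using (Dec; yes; no; dec⇒maybe)
open import Relation.Nullary.Negation using (contradiction)

-- With s = √z = tanh θ, `φ` at h is s coth(hθ), and shifting the argument by a quarter period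
-- exchanges s coth with s tanh = z `τ`. The residue sum has two points per row, one for raising its
-- beta number and a shifted one for lowering it. Only even powers of s then occur, so everything
-- stays in ℚ[[z]]. No analysis enters: the addition theorem of the cotangent yields the partial
-- fraction expansion by induction on the number of points. Each row brings a spare factor z, and
-- the common power is cancelled at the end because z is not a zero divisor.
--
-- A row of length 0 is appended to the partition. It makes room for a box in a new row, and its
-- beta number 0 removes the contribution of the one point that belongs to no row. Changing beta
-- numbers without regard to shape is harmless: if the result is no partition, two beta numbers
-- coincide and a factor `τ 0`, which is 0, appears.

length-∷ʳ : ∀ {a} {A : Set a} {y : A} xs → length (xs ∷ʳ y) ≡ suc (length xs)
length-∷ʳ xs = ≡.trans (length-++ xs) (ℕₚ.+-comm (length xs) 1)

-- Partitions, removable boxes, and hook lengths row by row.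

tail! : ∀ {x xs} → IsPartition (x ∷ xs) → IsPartition xs
tail! (one _)      = nil
tail! (cons _ xs!) = xs!

head! : ∀ {x xs} → IsPartition (x ∷ xs) → headOr0 xs ≤ x
head! (one _)      = z≤n
head! (cons y≤x _) = y≤x

head-pos : ∀ {x xs} → IsPartition (x ∷ xs) → 0 < x
head-pos (one 0<x)      = 0<x
head-pos (cons y≤x xs!) = ℕₚ.≤-trans (head-pos xs!) y≤x

-- A part lowered to 0 is dropped.
_∷₀_ : ℕ → List ℕ → List ℕ
zero  ∷₀ []       = []
zero  ∷₀ (x ∷ xs) = zero ∷ x ∷ xs
suc n ∷₀ xs       = suc n ∷ xs

lowerFirst : ℕ → List ℕ → List (List ℕ)
lowerFirst x xs with headOr0 xs ℕₚ.<? x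
... | yes _ = (pred x ∷₀ xs) ∷ []
... | no  _ = []

removeOne : List ℕ → List (List ℕ)
removeOne []       = []
removeOne (x ∷ xs) = lowerFirst x xs ++ map (x ∷_) (removeOne xs)

parts-≤ : ∀ {xs} → IsPartition xs → ∀ {b} → headOr0 xs ≤ b → All (_≤ b) xs
parts-≤ nil            _   = []
parts-≤ (one _)        x≤b = x≤b ∷ []
parts-≤ (cons y≤x xs!) x≤b = x≤b ∷ parts-≤ xs! (ℕₚ.≤-trans y≤x x≤b)

-- This is `cells` with an arbitrary row numbering: once the first row is peeled off, the others are
-- numbered by `suc`, and an induction has to cover that.
rows : (ℕ → ℕ) → List ℕ → List (ℕ × ℕ)
rows r xs = concat (zipWith (λ i len → map (i ,_) (upTo len)) (applyUpTo r (length xs)) xs)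

rows-suc : ∀ r xs → rows (λ i → suc (r i)) xs ≡ map (map₁ suc) (rows r xs)
rows-suc r []       = ≡.refl
rows-suc r (x ∷ xs) = ≡.trans
  (≡.cong₂ _++_ (map-∘ (upTo x)) (rows-suc (λ i → r (suc i)) xs))
  (≡.sym (map-++ (map₁ suc) (map (r 0 ,_) (upTo x)) _))

rows-columns : ∀ {b} r xs → All (_≤ b) xs → All (λ c → proj₂ c < b) (rows r xs)
rows-columns r []       []           = []
rows-columns r (x ∷ xs) (x≤b ∷ xs≤b) = Allₚ.++⁺
  (Allₚ.map⁺ (Allₚ.applyUpTo⁺₁ (λ i → i) x (λ i<x → ℕₚ.<-≤-trans i<x x≤b)))
  (rows-columns (λ i → r (suc i)) xs xs≤b)

conj-∷ : ∀ {x j} xs → j < x → conj (x ∷ xs) j ≡ suc (conj xs j)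
conj-∷ {x} {j} xs j<x = ≡.cong length (filter-accept (λ y → j ℕₚ.<? y) {x = x} {xs = xs} j<x)

conj-outside : ∀ {j xs} → All (_≤ j) xs → conj xs j ≡ 0
conj-outside {j} xs≤j = ≡.cong length (filter-none (λ y → j ℕₚ.<? y) (All.map ℕₚ.≤⇒≯ xs≤j))

hooks : List ℕ → List ℕ
hooks xs = map (hook xs) (cells xs)

firstHook : ℕ → List ℕ → ℕ → ℕ
firstHook x xs j = (x ∸ suc j) ℕ.+ conj xs j ℕ.+ 1

-- Every cell below the first row lies in a column of index less than `x`. Hence the first row adds
-- one to its column length and one to its row index, and the leg does not change.
hooks-∷ : ∀ {x xs} → IsPartition (x ∷ xs) →
  hooks (x ∷ xs) ≡ map (firstHook x xs) (upTo x) ++ hooks xs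
hooks-∷ {x} {xs} x∷xs! = ≡.trans
  (map-++ (hook (x ∷ xs)) (map (0 ,_) (upTo x)) _)
  (≡.cong₂ _++_
    (≡.trans (≡.sym (map-∘ (upTo x)))
      (map-cong-local (Allₚ.applyUpTo⁺₁ (λ i → i) x (λ {j} j<x →
        ≡.cong (λ n → (x ∸ suc j) ℕ.+ pred n ℕ.+ 1) (conj-∷ xs j<x)))))
    (≡.trans (≡.cong (map (hook (x ∷ xs))) (rows-suc (λ i → i) xs))
      (≡.trans (≡.sym (map-∘ (cells xs)))
        (map-cong-local (All.map (λ { {i , j} j<x →
            ≡.cong (λ n → (part xs i ∸ suc j) ℕ.+ (n ∸ suc (suc i)) ℕ.+ 1) (conj-∷ xs j<x) })
          (rows-columns (λ i → i) xs (parts-≤ (tail! x∷xs!) (head! x∷xs!))))))))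

-- Finite sums in a commutative ring.

module Sums {c ℓ} (R : CommutativeRing c ℓ) where

  open CommutativeRing R
  open import Algebra.Properties.CommutativeSemigroup +-commutativeSemigroup using (interchange)

  private variable
    x y : Level
    X : Set x
    Y : Set y

  sumOver : (X → Carrier) → List X → Carrier
  sumOver f xs = foldr _+_ 0# (map f xs)

  sumOver-map : ∀ (f : X → Carrier) (h : Y → X) ys →
    sumOver f (map h ys) ≡ sumOver (λ y → f (h y)) ys
  sumOver-map f h ys = ≡.cong (foldr _+_ 0#) (≡.sym (map-∘ ys))

  sumOver-cong : ∀ {f g : X → Carrier} {xs} → All (λ x → f x ≈ g x) xs → sumOver f xs ≈ sumOver g xs
  sumOver-cong []         = refl
  sumOver-cong (eq ∷ eqs) = +-cong eq (sumOver-cong eqs)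

  sumOver-0 : ∀ {f : X → Carrier} {xs} → All (λ x → f x ≈ 0#) xs → sumOver f xs ≈ 0#
  sumOver-0 []         = refl
  sumOver-0 (eq ∷ eqs) = trans (+-cong eq (sumOver-0 eqs)) (+-identityˡ 0#)

  sumOver-+ : ∀ (f g : X → Carrier) xs → sumOver (λ x → f x + g x) xs ≈ sumOver f xs + sumOver g xs
  sumOver-+ f g []       = sym (+-identityˡ 0#)
  sumOver-+ f g (x ∷ xs) = trans (+-congˡ (sumOver-+ f g xs)) (interchange _ _ _ _)

  sumOver-* : ∀ a (f : X → Carrier) xs → sumOver (λ x → a * f x) xs ≈ a * sumOver f xs
  sumOver-* a f []       = sym (zeroʳ a)
  sumOver-* a f (x ∷ xs) = trans (+-congˡ (sumOver-* a f xs)) (sym (distribˡ _ _ _))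

  sumOver-++ : ∀ (f : X → Carrier) xs ys → sumOver f (xs ++ ys) ≈ sumOver f xs + sumOver f ys
  sumOver-++ f []       ys = sym (+-identityˡ _)
  sumOver-++ f (x ∷ xs) ys = trans (+-congˡ (sumOver-++ f xs ys)) (sym (+-assoc _ _ _))

  sumOver-concatMap : ∀ (f : X → Carrier) (h : Y → List X) ys →
    sumOver f (concatMap h ys) ≈ sumOver (λ y → sumOver f (h y)) ys
  sumOver-concatMap f h []       = refl
  sumOver-concatMap f h (y ∷ ys) = trans (sumOver-++ f (h y) _) (+-congˡ (sumOver-concatMap f h ys))

  sumOver-swap : ∀ (f : X → Y → Carrier) xs ys →
    sumOver (λ x → sumOver (f x) ys) xs ≈ sumOver (λ y → sumOver (λ x → f x y) xs) ys
  sumOver-swap f []       ys = sym (sumOver-0 (All.universal (λ _ → refl) ys))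
  sumOver-swap f (x ∷ xs) ys = trans (+-congˡ (sumOver-swap f xs ys)) (sym (sumOver-+ _ _ ys))

  sumOver-filter : ∀ {q} {Q : X → Set q} (Q? : ∀ x → Dec (Q x)) {f} {xs} →
    All (λ x → Q x ⊎ f x ≈ 0#) xs → sumOver f (filter Q? xs) ≈ sumOver f xs
  sumOver-filter Q? []                 = refl
  sumOver-filter Q? {xs = x ∷ xs} (q ∷ qs) with Q? x | q
  ... | yes _ | _         = +-congˡ (sumOver-filter Q? qs)
  ... | no ¬q | inj₁ q    = contradiction q ¬q
  ... | no ¬q | inj₂ fx≈0 = trans (sumOver-filter Q? qs)
                              (trans (sym (+-identityˡ _)) (+-congʳ (sym fx≈0)))

  sumOver-applyUpTo : ∀ (f : X → Carrier) (r : ℕ → X) {j n} → j < n →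
    (∀ i → i ≢ j → f (r i) ≈ 0#) → sumOver f (applyUpTo r n) ≈ f (r j)
  sumOver-applyUpTo f r {zero}  {suc n} _ f≈0 = trans
    (+-congˡ (sumOver-0 (Allₚ.applyUpTo⁺₂ (λ i → r (suc i)) n (λ i → f≈0 (suc i) (λ ())))))
    (+-identityʳ _)
  sumOver-applyUpTo f r {suc j} {suc n} (s≤s j<n) f≈0 = trans (+-congʳ (f≈0 0 (λ ())))
    (trans (+-identityˡ _)
      (sumOver-applyUpTo f (λ i → r (suc i)) j<n (λ i i≢j → f≈0 (suc i) (λ eq → i≢j (ℕₚ.suc-injective eq)))))

-- Hook weights over a commutative ℚ-algebra

module ℚAlgebra {c ℓ} (A : CommutativeRing c ℓ)
  (ι : CommutativeRing.rawRing ℚₚ.+-*-commutativeRing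
         -Raw-AlmostCommutative⟶ fromCommutativeRing A) where

  open CommutativeRing A
  open Sums A
  open RingProperties ring using (-‿distribˡ-*; -0#≈0#)
  open SetoidReasoning setoid
  open _-Raw-AlmostCommutative⟶_ ι using (⟦_⟧)
  module Solver = RingSolver _ _ ι
    (λ p q → Maybe.map (λ p≡q → reflexive (≡.cong ⟦_⟧ p≡q)) (dec⇒maybe (p ℚₚ.≟ q)))
  open Solver using (solve; _:*_; _:+_; _:-_; :-_; _:=_)

  -- Partial fractions of products of cotangents.

  module PartialFractions {p} {P : Set p} (cot : P → P → Carrier) (z : Carrier) where

    cotProd : P → List P → Carrier
    cotProd u []      = 1#
    cotProd u (q ∷ Q) = cot u q * cotProd u Q

    -- Σ_p w(p) ∏_{q ≠ p} cot(p, q), where cot is used only from earlier to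
    -- later points and extended to the other pairs by antisymmetry.
    residueSum : (P → Carrier) → List P → Carrier
    residueSum w []      = 0#
    residueSum w (p ∷ Q) = w p * cotProd p Q + residueSum (λ q → w q * - cot p q) Q

    -- With s² = z, a cotangent scaled by s tends to s and -s at the two ends. The constant term of
    -- a product of n of them is the average of the two limits, (sⁿ + (-s)ⁿ) / 2.
    constantTerm : ℕ → Carrier
    constantTerm 0             = 1#
    constantTerm 1             = 0#
    constantTerm (suc (suc n)) = z * constantTerm n

    residueSum-cong : ∀ {w v} Q → All (λ q → w q ≈ v q) Q → residueSum w Q ≈ residueSum v Q
    residueSum-cong []      []         = refl
    residueSum-cong (p ∷ Q) (eq ∷ eqs) =
      +-cong (*-congʳ eq) (residueSum-cong Q (All.map *-congʳ eqs))

    residueSum-+ : ∀ w v Q → residueSum (λ q → w q + v q) Q ≈ residueSum w Q + residueSum v Q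
    residueSum-+ w v []      = sym (+-identityʳ 0#)
    residueSum-+ w v (p ∷ Q) = begin
      (w p + v p) * cotProd p Q + residueSum (λ q → (w q + v q) * - cot p q) Q
        ≈⟨ +-congˡ (residueSum-cong Q (All.universal (λ q → distribʳ _ _ _) Q)) ⟩
      (w p + v p) * cotProd p Q + residueSum (λ q → w q * - cot p q + v q * - cot p q) Q
        ≈⟨ +-congˡ (residueSum-+ _ _ Q) ⟩
      (w p + v p) * cotProd p Q + (residueSum _ Q + residueSum _ Q)
        ≈⟨ solve 5 (λ a b c d e → (a :+ b) :* c :+ (d :+ e) := (a :* c :+ d) :+ (b :* c :+ e))
             refl _ _ _ _ _ ⟩
      _ ∎

    residueSum-* : ∀ a w Q → residueSum (λ q → a * w q) Q ≈ a * residueSum w Q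
    residueSum-* a w []      = sym (zeroʳ a)
    residueSum-* a w (p ∷ Q) = begin
      (a * w p) * cotProd p Q + residueSum (λ q → (a * w q) * - cot p q) Q
        ≈⟨ +-cong (*-assoc _ _ _)
             (residueSum-cong Q (All.universal (λ q → *-assoc _ _ _) Q)) ⟩
      a * (w p * cotProd p Q) + residueSum (λ q → a * (w q * - cot p q)) Q
        ≈⟨ +-congˡ (residueSum-* a _ Q) ⟩
      a * (w p * cotProd p Q) + a * residueSum (λ q → w q * - cot p q) Q
        ≈⟨ distribˡ _ _ _ ⟨
      _ ∎

    module _ {r} {_≻_ : P → P → Set r}
      (cot-law : ∀ {u p q} → u ≻ p → p ≻ q → u ≻ q →
                 cot u q * (cot u p + cot p q) ≈ cot u p * cot p q + z) where

      -- The partial fraction expansion of u ↦ ∏_q cot(u, q).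
      cotProd-expansion : ∀ u Q → All (u ≻_) Q → AllPairs _≻_ Q →
        cotProd u Q ≈ constantTerm (length Q) + residueSum (cot u) Q

      -- This is the expansion of `cotProd` at the first point itself: by antisymmetry the later
      -- points enter the residue sum with exactly the terms that the expansion adds to the constant
      -- term.
      residueSum-1 : ∀ p Q → All (p ≻_) Q → AllPairs _≻_ Q →
        residueSum (λ _ → 1#) (p ∷ Q) ≈ constantTerm (length Q)
      residueSum-1 p Q p≻Q Q! = begin
        1# * cotProd p Q + residueSum (λ q → 1# * - cot p q) Q
          ≈⟨ +-cong (*-identityˡ _) (residueSum-cong Q (All.universal neg Q)) ⟩
        cotProd p Q + residueSum (λ q → - 1# * cot p q) Q
          ≈⟨ +-cong (cotProd-expansion p Q p≻Q Q!) (residueSum-* _ _ Q) ⟩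
        (constantTerm (length Q) + residueSum (cot p) Q) + - 1# * residueSum (cot p) Q
          ≈⟨ +-congˡ (-‿distribˡ-* 1# _) ⟨
        (constantTerm (length Q) + residueSum (cot p) Q) + - (1# * residueSum (cot p) Q)
          ≈⟨ +-congˡ (-‿cong (*-identityˡ _)) ⟩
        (constantTerm (length Q) + residueSum (cot p) Q) + - residueSum (cot p) Q
          ≈⟨ solve 2 (λ a b → a :+ b :- b := a) refl _ _ ⟩
        constantTerm (length Q) ∎
        where
        neg : ∀ q → 1# * - cot p q ≈ - 1# * cot p q
        neg q = solve 2 (λ a b → a :* :- b := :- a :* b) refl _ _

      -- The factor `z` brings the empty list under the same formula, because `constantTerm 1` is 0.
      z*residueSum-1 : ∀ Q → AllPairs _≻_ Q →
        z * residueSum (λ _ → 1#) Q ≈ constantTerm (suc (length Q))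
      z*residueSum-1 []      _          = zeroʳ z
      z*residueSum-1 (p ∷ Q) (p≻Q ∷ Q!) = *-congˡ (residueSum-1 p Q p≻Q Q!)

      cotProd-expansion u []      _            _          = sym (+-identityʳ 1#)
      cotProd-expansion u (p ∷ Q) (u≻p ∷ u≻Q) (p≻Q ∷ Q!) = begin
        cot u p * cotProd u Q
          ≈⟨ *-congˡ (cotProd-expansion u Q u≻Q Q!) ⟩
        cot u p * (K + residueSum (cot u) Q)
          ≈⟨ distribˡ _ _ _ ⟩
        cot u p * K + cot u p * residueSum (cot u) Q
          ≈⟨ +-congˡ (residueSum-* _ _ Q) ⟨
        cot u p * K + residueSum (λ q → cot u p * cot u q) Q
          -- The addition theorem splits a product of two cotangents at `u` into terms with at most
          -- one of them. The constants `z` add up, by `z*residueSum-1`, to the constant term for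
          -- one more point.
          ≈⟨ +-congˡ (residueSum-cong Q (All.zipWith law (u≻Q , p≻Q))) ⟩
        cot u p * K + residueSum (λ q → (z * 1# + cot u p * cot p q) + cot u q * - cot p q) Q
          ≈⟨ +-congˡ (residueSum-+ _ _ Q) ⟩
        cot u p * K + (residueSum (λ q → z * 1# + cot u p * cot p q) Q + R)
          ≈⟨ +-congˡ (+-congʳ (residueSum-+ _ _ Q)) ⟩
        cot u p * K + ((residueSum (λ q → z * 1#) Q + residueSum (λ q → cot u p * cot p q) Q) + R)
          ≈⟨ +-congˡ (+-congʳ (+-cong (trans (residueSum-* z _ Q) (z*residueSum-1 Q Q!))
                                      (residueSum-* _ _ Q))) ⟩
        cot u p * K + ((constantTerm (suc (length Q)) + cot u p * residueSum (cot p) Q) + R)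
          ≈⟨ solve 5 (λ a k c s r → a :* k :+ ((c :+ a :* s) :+ r) := c :+ (a :* (k :+ s) :+ r))
               refl _ _ _ _ _ ⟩
        constantTerm (suc (length Q)) + (cot u p * (K + residueSum (cot p) Q) + R)
          ≈⟨ +-congˡ (+-congʳ (*-congˡ (cotProd-expansion p Q p≻Q Q!))) ⟨
        constantTerm (suc (length Q)) + (cot u p * cotProd p Q + R) ∎
        where
        K = constantTerm (length Q)
        R = residueSum (λ q → cot u q * - cot p q) Q

        law : ∀ {q} → (u ≻ q) × (p ≻ q) →
          cot u p * cot u q ≈ (z * 1# + cot u p * cot p q) + cot u q * - cot p q
        law {q} (u≻q , p≻q) = begin
          cot u p * cot u q
            ≈⟨ solve 3 (λ a b c → a :* c := c :* (a :+ b) :+ c :* :- b) refl _ _ _ ⟩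
          cot u q * (cot u p + cot p q) + cot u q * - cot p q
            ≈⟨ +-congʳ (cot-law u≻p p≻q u≻q) ⟩
          (cot u p * cot p q + z) + cot u q * - cot p q
            ≈⟨ +-congʳ (trans (+-comm _ _) (+-congʳ (sym (*-identityʳ z)))) ⟩
          _ ∎

  -- Even and odd parts of (1 + √z)ⁿ, and their quotients.

  module Hyperbolic (z : Carrier) (e o e⁻¹ φ τ : ℕ → Carrier)
    (e-0 : e 0 ≈ 1#) (o-0 : o 0 ≈ 0#)
    (e-suc : ∀ n → e (suc n) ≈ e n + z * o n)
    (o-suc : ∀ n → o (suc n) ≈ e n + o n)
    (e*e⁻¹ : ∀ n → e n * e⁻¹ n ≈ 1#)
    (o*φ : ∀ n → o (suc n) * φ (suc n) ≈ e (suc n))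
    (e*τ : ∀ n → e n * τ n ≈ o n)
    where

    e-cancel : ∀ n {x y} → e n * x ≈ e n * y → x ≈ y
    e-cancel n {x} {y} eq = begin
      x                  ≈⟨ expand x ⟩
      e⁻¹ n * (e n * x)  ≈⟨ *-congˡ eq ⟩
      e⁻¹ n * (e n * y)  ≈⟨ expand y ⟨
      y                  ∎
      where
      expand : ∀ x → x ≈ e⁻¹ n * (e n * x)
      expand x = begin
        x                  ≈⟨ *-identityˡ x ⟨
        1# * x             ≈⟨ *-congʳ (trans (*-comm _ _) (e*e⁻¹ n)) ⟨
        (e⁻¹ n * e n) * x  ≈⟨ *-assoc _ _ _ ⟩
        e⁻¹ n * (e n * x)  ∎

    -- Both addition formulas compare the parts of (1 + √z)ᵐ (1 + √z)ⁿ. They are proved together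
    -- because the recursions for `e` and `o` mix the two parts.
    e-+ : ∀ m n → e (m ℕ.+ n) ≈ e m * e n + z * (o m * o n)
    o-+ : ∀ m n → o (m ℕ.+ n) ≈ o m * e n + e m * o n
    e-+ zero    n = sym (begin
      e 0 * e n + z * (o 0 * o n)
        ≈⟨ +-cong (trans (*-congʳ e-0) (*-identityˡ _))
                  (*-congˡ (trans (*-congʳ {o n} o-0) (zeroˡ (o n)))) ⟩
      e n + z * 0#
        ≈⟨ trans (+-congˡ (zeroʳ z)) (+-identityʳ _) ⟩
      e n ∎)
    e-+ (suc m) n = begin
      e (suc (m ℕ.+ n))
        ≈⟨ e-suc (m ℕ.+ n) ⟩
      e (m ℕ.+ n) + z * o (m ℕ.+ n)
        ≈⟨ +-cong (e-+ m n) (*-congˡ (o-+ m n)) ⟩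
      (e m * e n + z * (o m * o n)) + z * (o m * e n + e m * o n)
        ≈⟨ solve 5 (λ e f z o p → (e :* f :+ z :* (o :* p)) :+ z :* (o :* f :+ e :* p)
                      := (e :+ z :* o) :* f :+ z :* ((e :+ o) :* p)) refl _ _ _ _ _ ⟩
      (e m + z * o m) * e n + z * ((e m + o m) * o n)
        ≈⟨ +-cong (*-congʳ (e-suc m)) (*-congˡ (*-congʳ (o-suc m))) ⟨
      e (suc m) * e n + z * (o (suc m) * o n) ∎
    o-+ zero    n = sym (begin
      o 0 * e n + e 0 * o n
        ≈⟨ +-cong (trans (*-congʳ {e n} o-0) (zeroˡ (e n)))
                  (trans (*-congʳ e-0) (*-identityˡ _)) ⟩
      0# + o n
        ≈⟨ +-identityˡ _ ⟩
      o n ∎)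
    o-+ (suc m) n = begin
      o (suc (m ℕ.+ n))
        ≈⟨ o-suc (m ℕ.+ n) ⟩
      e (m ℕ.+ n) + o (m ℕ.+ n)
        ≈⟨ +-cong (e-+ m n) (o-+ m n) ⟩
      (e m * e n + z * (o m * o n)) + (o m * e n + e m * o n)
        ≈⟨ solve 5 (λ e f z o p → (e :* f :+ z :* (o :* p)) :+ (o :* f :+ e :* p)
                      := (e :+ o) :* f :+ (e :+ z :* o) :* p) refl _ _ _ _ _ ⟩
      (e m + o m) * e n + (e m + z * o m) * o n
        ≈⟨ +-cong (*-congʳ (o-suc m)) (*-congʳ (e-suc m)) ⟨
      o (suc m) * e n + e (suc m) * o n ∎

    τ-0 : τ 0 ≈ 0#
    τ-0 = e-cancel 0 (trans (e*τ 0) (trans o-0 (sym (zeroʳ (e 0)))))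

    τ-1 : τ 1 ≈ 1#
    τ-1 = e-cancel 1 (begin
      e 1 * τ 1      ≈⟨ e*τ 1 ⟩
      o 1            ≈⟨ o-suc 0 ⟩
      e 0 + o 0      ≈⟨ +-congˡ (trans o-0 (sym (trans (*-congˡ o-0) (zeroʳ z)))) ⟩
      e 0 + z * o 0  ≈⟨ e-suc 0 ⟨
      e 1            ≈⟨ *-identityʳ (e 1) ⟨
      e 1 * 1#       ∎)

    φ*τ : ∀ n → φ (suc n) * τ (suc n) ≈ 1#
    φ*τ n = e-cancel h (begin
      e h * (φ h * τ h)  ≈⟨ solve 3 (λ e f t → e :* (f :* t) := (e :* t) :* f) refl _ _ _ ⟩
      (e h * τ h) * φ h  ≈⟨ *-congʳ (e*τ h) ⟩
      o h * φ h          ≈⟨ o*φ n ⟩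
      e h                ≈⟨ *-identityʳ _ ⟨
      e h * 1#           ∎)
      where h = suc n

    -- Since `e m` and `e n` are invertible, both sides may be multiplied by them; this turns the
    -- claim into the addition formulas for `e` and `o`.
    τ-add : ∀ m n → τ (m ℕ.+ n) * (1# + z * (τ m * τ n)) ≈ τ m + τ n
    τ-add m n = e-cancel m (e-cancel n (begin
      e n * (e m * (τ (m ℕ.+ n) * (1# + z * (τ m * τ n))))
        ≈⟨ solve 7 (λ e f t o z p q → f :* (e :* (t :* (o :+ z :* (p :* q))))
                      := t :* (o :* (e :* f) :+ z :* ((e :* p) :* (f :* q)))) refl _ _ _ _ _ _ _ ⟩
      τ (m ℕ.+ n) * (1# * (e m * e n) + z * ((e m * τ m) * (e n * τ n)))
        ≈⟨ *-congˡ (+-cong (*-identityˡ _) (*-congˡ (*-cong (e*τ m) (e*τ n)))) ⟩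
      τ (m ℕ.+ n) * (e m * e n + z * (o m * o n))
        ≈⟨ *-congˡ (e-+ m n) ⟨
      τ (m ℕ.+ n) * e (m ℕ.+ n)
        ≈⟨ *-comm (τ (m ℕ.+ n)) (e (m ℕ.+ n)) ⟩
      e (m ℕ.+ n) * τ (m ℕ.+ n)
        ≈⟨ e*τ (m ℕ.+ n) ⟩
      o (m ℕ.+ n)
        ≈⟨ o-+ m n ⟩
      o m * e n + e m * o n
        ≈⟨ +-cong (*-congʳ (e*τ m)) (*-congˡ (e*τ n)) ⟨
      (e m * τ m) * e n + e m * (e n * τ n)
        ≈⟨ solve 4 (λ e f p q → (e :* p) :* f :+ e :* (f :* q) := f :* (e :* (p :+ q))) refl _ _ _ _ ⟩
      e n * (e m * (τ m + τ n)) ∎))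

  -- The addition theorem for points of two kinds.

  module HookProducts (z : Carrier) (φ τ : ℕ → Carrier)
    (τ-0 : τ 0 ≈ 0#) (τ-1 : τ 1 ≈ 1#)
    (φ*τ : ∀ n → φ (suc n) * τ (suc n) ≈ 1#)
    (τ-add : ∀ m n → τ (m ℕ.+ n) * (1# + z * (τ m * τ n)) ≈ τ m + τ n)
    where

    φ*τ-pos : ∀ {n} → 0 < n → φ n * τ n ≈ 1#
    φ*τ-pos {suc n} _ = φ*τ n

    -- Multiplying `τ-add` by `φ m` inverts only one of the tangents. So `n` may be 0, which is
    -- needed for points of different kinds at the same position.
    φτ-add : ∀ m n → 0 < m → τ (m ℕ.+ n) * (φ m + z * τ n) ≈ φ m * τ n + 1#
    φτ-add m n 0<m = begin
      τ (m ℕ.+ n) * (φ m + z * τ n)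
        ≈⟨ *-congˡ (+-congˡ (trans (sym (*-identityˡ _)) (*-congʳ (sym (φ*τ-pos 0<m))))) ⟩
      τ (m ℕ.+ n) * (φ m + (φ m * τ m) * (z * τ n))
        ≈⟨ *-congˡ (+-congʳ (sym (*-identityʳ _))) ⟩
      τ (m ℕ.+ n) * (φ m * 1# + (φ m * τ m) * (z * τ n))
        ≈⟨ solve 6 (λ t f o tm z tn → t :* (f :* o :+ (f :* tm) :* (z :* tn))
                      := f :* (t :* (o :+ z :* (tm :* tn)))) refl _ _ _ _ _ _ ⟩
      φ m * (τ (m ℕ.+ n) * (1# + z * (τ m * τ n)))
        ≈⟨ *-congˡ (τ-add m n) ⟩
      φ m * (τ m + τ n)
        ≈⟨ distribˡ _ _ _ ⟩
      φ m * τ m + φ m * τ n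
        ≈⟨ +-congʳ (φ*τ-pos 0<m) ⟩
      1# + φ m * τ n
        ≈⟨ +-comm _ _ ⟩
      φ m * τ n + 1# ∎

    φφ-add : ∀ m n → 0 < m → 0 < n → φ (m ℕ.+ n) * (φ m + φ n) ≈ φ m * φ n + z
    φφ-add m n 0<m 0<n = begin
      φ (m ℕ.+ n) * (φ m + φ n)
        ≈⟨ *-congˡ (trans (+-comm _ _) (+-cong (insert (φ*τ-pos 0<m)) (insert (φ*τ-pos 0<n)))) ⟩
      φ (m ℕ.+ n) * ((φ m * τ m) * φ n + (φ n * τ n) * φ m)
        ≈⟨ solve 5 (λ f fm fn tm tn → f :* ((fm :* tm) :* fn :+ (fn :* tn) :* fm)
                      := (f :* (fm :* fn)) :* (tm :+ tn)) refl _ _ _ _ _ ⟩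
      (φ (m ℕ.+ n) * (φ m * φ n)) * (τ m + τ n)
        ≈⟨ *-congˡ (τ-add m n) ⟨
      (φ (m ℕ.+ n) * (φ m * φ n)) * (τ (m ℕ.+ n) * (1# + z * (τ m * τ n)))
        ≈⟨ solve 8 (λ f fm fn t o z tm tn → (f :* (fm :* fn)) :* (t :* (o :+ z :* (tm :* tn)))
                      := (f :* t) :* (o :* (fm :* fn) :+ (fm :* tm) :* ((fn :* tn) :* z)))
                      refl _ _ _ _ _ _ _ _ ⟩
      (φ (m ℕ.+ n) * τ (m ℕ.+ n)) * (1# * (φ m * φ n) + (φ m * τ m) * ((φ n * τ n) * z))
        ≈⟨ remove (φ*τ-pos (ℕₚ.≤-trans 0<m (ℕₚ.m≤m+n m n))) ⟩
      1# * (φ m * φ n) + (φ m * τ m) * ((φ n * τ n) * z)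
        ≈⟨ +-cong (*-identityˡ _) (trans (remove (φ*τ-pos 0<m)) (remove (φ*τ-pos 0<n))) ⟩
      φ m * φ n + z ∎
      where
      insert : ∀ {x y} → x ≈ 1# → y ≈ x * y
      insert x≈1 = sym (trans (*-congʳ x≈1) (*-identityˡ _))
      remove : ∀ {x y} → x ≈ 1# → x * y ≈ y
      remove x≈1 = trans (*-congʳ x≈1) (*-identityˡ _)

    -- In terms of the cotangent-like function φ, the shifted points Y differ
    -- from the points X by a quarter period, which turns φ into z * τ.
    data Point : Set where
      X Y : ℕ → Point

    cot : Point → Point → Carrier
    cot (X a) (X b) = φ (a ∸ b)
    cot (X a) (Y b) = z * τ (a ∸ b)
    cot (Y a) (X b) = z * τ (a ∸ b)
    cot (Y a) (Y b) = φ (a ∸ b)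

    -- Points of different kinds may coincide, since `τ 0` is a legitimate value, while the
    -- cotangent has a pole at 0. The relation is therefore not transitive: `X a ≻ Y a` and
    -- `Y a ≻ X a`, but not `X a ≻ X a`. This is why `cot-law` asks for all three comparisons.
    data _≻_ : Point → Point → Set where
      X≻X : ∀ {a b} → b < a → X a ≻ X b
      X≻Y : ∀ {a b} → b ≤ a → X a ≻ Y b
      Y≻X : ∀ {a b} → b ≤ a → Y a ≻ X b
      Y≻Y : ∀ {a b} → b < a → Y a ≻ Y b

    private
      ∸-split : ∀ {a b c} → b ≤ a → c ≤ b → a ∸ c ≡ (a ∸ b) ℕ.+ (b ∸ c)
      ∸-split {a} {b} {c} b≤a c≤b = ≡.trans
        (≡.cong (_∸ c) (≡.sym (ℕₚ.m∸n+n≡m b≤a))) (ℕₚ.+-∸-assoc (a ∸ b) c≤b)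

      module _ {a b c} (b≤a : b ≤ a) (c≤b : c ≤ b) where

        m n : ℕ
        m = a ∸ b
        n = b ∸ c

        -- The letters of the names give the functions behind `cot u q`, `cot u p` and `cot p q`.
        -- Exchanging the two kinds of points preserves them, so four lemmas serve the eight cases
        -- of `cot-law`.
        φφφ : 0 < m → 0 < n → φ (a ∸ c) * (φ m + φ n) ≈ φ m * φ n + z
        φφφ 0<m 0<n rewrite ∸-split b≤a c≤b = φφ-add m n 0<m 0<n

        τφτ : 0 < m → (z * τ (a ∸ c)) * (φ m + z * τ n) ≈ φ m * (z * τ n) + z
        τφτ 0<m rewrite ∸-split b≤a c≤b = begin
          (z * τ (m ℕ.+ n)) * (φ m + z * τ n)  ≈⟨ *-assoc _ _ _ ⟩
          z * (τ (m ℕ.+ n) * (φ m + z * τ n))  ≈⟨ *-congˡ (φτ-add m n 0<m) ⟩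
          z * (φ m * τ n + 1#)                 ≈⟨ solve 4 (λ z f t o → z :* (f :* t :+ o)
                                                     := f :* (z :* t) :+ z :* o) refl _ _ _ _ ⟩
          φ m * (z * τ n) + z * 1#             ≈⟨ +-congˡ (*-identityʳ z) ⟩
          φ m * (z * τ n) + z                  ∎

        ττφ : 0 < n → (z * τ (a ∸ c)) * (z * τ m + φ n) ≈ (z * τ m) * φ n + z
        ττφ 0<n rewrite ∸-split b≤a c≤b | ℕₚ.+-comm m n = begin
          (z * τ (n ℕ.+ m)) * (z * τ m + φ n)  ≈⟨ solve 4 (λ z t tm f → (z :* t) :* (z :* tm :+ f)
                                                     := z :* (t :* (f :+ z :* tm))) refl _ _ _ _ ⟩
          z * (τ (n ℕ.+ m) * (φ n + z * τ m))  ≈⟨ *-congˡ (φτ-add n m 0<n) ⟩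
          z * (φ n * τ m + 1#)                 ≈⟨ solve 4 (λ z f t o → z :* (f :* t :+ o)
                                                     := (z :* t) :* f :+ z :* o) refl _ _ _ _ ⟩
          (z * τ m) * φ n + z * 1#             ≈⟨ +-congˡ (*-identityʳ z) ⟩
          (z * τ m) * φ n + z                  ∎

        φττ : 0 < m ℕ.+ n → φ (a ∸ c) * (z * τ m + z * τ n) ≈ (z * τ m) * (z * τ n) + z
        φττ 0<m+n rewrite ∸-split b≤a c≤b = begin
          φ (m ℕ.+ n) * (z * τ m + z * τ n)
            ≈⟨ solve 4 (λ f z a b → f :* (z :* a :+ z :* b) := z :* (f :* (a :+ b))) refl _ _ _ _ ⟩
          z * (φ (m ℕ.+ n) * (τ m + τ n))
            ≈⟨ *-congˡ (*-congˡ (τ-add m n)) ⟨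
          z * (φ (m ℕ.+ n) * (τ (m ℕ.+ n) * (1# + z * (τ m * τ n))))
            ≈⟨ *-congˡ (*-assoc _ _ _) ⟨
          z * ((φ (m ℕ.+ n) * τ (m ℕ.+ n)) * (1# + z * (τ m * τ n)))
            ≈⟨ *-congˡ (trans (*-congʳ (φ*τ-pos 0<m+n)) (*-identityˡ _)) ⟩
          z * (1# + z * (τ m * τ n))
            ≈⟨ solve 4 (λ z o a b → z :* (o :+ z :* (a :* b)) := (z :* a) :* (z :* b) :+ z :* o)
                 refl _ _ _ _ ⟩
          (z * τ m) * (z * τ n) + z * 1#
            ≈⟨ +-congˡ (*-identityʳ z) ⟩
          (z * τ m) * (z * τ n) + z ∎

      0<m+n : ∀ {a b c} → b ≤ a → c ≤ b → c < a → 0 < (a ∸ b) ℕ.+ (b ∸ c)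
      0<m+n b≤a c≤b c<a rewrite ≡.sym (∸-split b≤a c≤b) = ℕₚ.m<n⇒0<n∸m c<a

    cot-law : ∀ {u p q} → u ≻ p → p ≻ q → u ≻ q →
              cot u q * (cot u p + cot p q) ≈ cot u p * cot p q + z
    cot-law (X≻X i) (X≻X j) (X≻X k) =
      φφφ (ℕₚ.<⇒≤ i) (ℕₚ.<⇒≤ j) (ℕₚ.m<n⇒0<n∸m i) (ℕₚ.m<n⇒0<n∸m j)
    cot-law (X≻X i) (X≻Y j) (X≻Y k) = τφτ (ℕₚ.<⇒≤ i) j (ℕₚ.m<n⇒0<n∸m i)
    cot-law (X≻Y i) (Y≻X j) (X≻X k) = φττ i j (0<m+n i j k)
    cot-law (X≻Y i) (Y≻Y j) (X≻Y k) = ττφ i (ℕₚ.<⇒≤ j) (ℕₚ.m<n⇒0<n∸m j)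
    cot-law (Y≻X i) (X≻X j) (Y≻X k) = ττφ i (ℕₚ.<⇒≤ j) (ℕₚ.m<n⇒0<n∸m j)
    cot-law (Y≻X i) (X≻Y j) (Y≻Y k) = φττ i j (0<m+n i j k)
    cot-law (Y≻Y i) (Y≻X j) (Y≻X k) = τφτ (ℕₚ.<⇒≤ i) j (ℕₚ.m<n⇒0<n∸m i)
    cot-law (Y≻Y i) (Y≻Y j) (Y≻Y k) =
      φφφ (ℕₚ.<⇒≤ i) (ℕₚ.<⇒≤ j) (ℕₚ.m<n⇒0<n∸m i) (ℕₚ.m<n⇒0<n∸m j)

    open PartialFractions cot z

    -- A row with beta number l contributes the points l + 1 and l; the last
    -- point stands for the row that a box may always be appended to.
    points : List ℕ → List Point
    points []       = X 0 ∷ []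
    points (l ∷ ls) = X (suc l) ∷ Y l ∷ points ls

    Φ : ℕ → Carrier
    Φ zero    = 1#
    Φ (suc n) = φ (suc n) * Φ n

    -- The product of φ over the hook lengths in the first row, respectively in
    -- all rows, of the partition with beta numbers l ∷ ls.
    rowWeight : ℕ → List ℕ → Carrier
    rowWeight l []       = Φ l
    rowWeight l (m ∷ ms) = τ (l ∸ m) * rowWeight l ms

    weight : List ℕ → Carrier
    weight []       = 1#
    weight (l ∷ ls) = rowWeight l ls * weight ls

    -- Raising and lowering one beta number at a time.

    raiseSum : (ℕ → Carrier) → (List ℕ → Carrier) → List ℕ → Carrier
    raiseSum w f []       = 0#
    raiseSum w f (l ∷ ls) = w l * f (suc l ∷ ls) + raiseSum w (λ ms → f (l ∷ ms)) ls

    lowerHead : (List ℕ → Carrier) → ℕ → List ℕ → Carrier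
    lowerHead f zero    ls = 0#
    lowerHead f (suc l) ls = f (l ∷ ls)

    lowerSum : (ℕ → Carrier) → (List ℕ → Carrier) → List ℕ → Carrier
    lowerSum w f []       = 0#
    lowerSum w f (l ∷ ls) = w l * lowerHead f l ls + lowerSum w (λ ms → f (l ∷ ms)) ls

    lowerHead-cong : ∀ {f g} → (∀ ms → f ms ≈ g ms) → ∀ l ls → lowerHead f l ls ≈ lowerHead g l ls
    lowerHead-cong f≈g zero    ls = refl
    lowerHead-cong f≈g (suc l) ls = f≈g (l ∷ ls)

    raiseSum-cong : ∀ {w v f g} → (∀ m → w m ≈ v m) → (∀ ms → f ms ≈ g ms) →
                    ∀ ls → raiseSum w f ls ≈ raiseSum v g ls
    raiseSum-cong w≈v f≈g []       = refl
    raiseSum-cong w≈v f≈g (l ∷ ls) =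
      +-cong (*-cong (w≈v l) (f≈g _)) (raiseSum-cong w≈v (λ ms → f≈g (l ∷ ms)) ls)

    lowerSum-cong : ∀ {w v f g} → (∀ m → w m ≈ v m) → (∀ ms → f ms ≈ g ms) →
                    ∀ ls → lowerSum w f ls ≈ lowerSum v g ls
    lowerSum-cong w≈v f≈g []       = refl
    lowerSum-cong w≈v f≈g (l ∷ ls) =
      +-cong (*-cong (w≈v l) (lowerHead-cong f≈g l ls)) (lowerSum-cong w≈v (λ ms → f≈g (l ∷ ms)) ls)

    raiseSum-* : ∀ a w f ls → raiseSum (λ m → a * w m) f ls ≈ a * raiseSum w f ls
    raiseSum-* a w f []       = sym (zeroʳ a)
    raiseSum-* a w f (l ∷ ls) = trans (+-cong (*-assoc _ _ _) (raiseSum-* a w _ ls)) (sym (distribˡ _ _ _))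

    lowerSum-* : ∀ a w f ls → lowerSum (λ m → a * w m) f ls ≈ a * lowerSum w f ls
    lowerSum-* a w f []       = sym (zeroʳ a)
    lowerSum-* a w f (l ∷ ls) = trans (+-cong (*-assoc _ _ _) (lowerSum-* a w _ ls)) (sym (distribˡ _ _ _))

    -- Raising m replaces the factor τ(l - m) of the row above by τ(l - m - 1). With φ as the
    -- reciprocal of τ, the quotient of the two factors is moved into the weight `w`.
    raiseSum-rowWeight : ∀ w f l ls → All (_< l) ls →
      raiseSum w (λ ms → rowWeight l ms * f ms) ls ≈
      rowWeight l ls * raiseSum (λ m → w m * (φ (l ∸ m) * τ (l ∸ suc m))) f ls
    raiseSum-rowWeight w f l []       []             = sym (zeroʳ _)
    raiseSum-rowWeight w f l (m ∷ ms) (m<l ∷ ms<l) = begin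
      w m * ((τ (l ∸ suc m) * rowWeight l ms) * f (suc m ∷ ms)) +
        raiseSum w (λ ns → (τ (l ∸ m) * rowWeight l ns) * f (m ∷ ns)) ms
        ≈⟨ +-cong (sym (trans (*-congʳ (φ*τ-pos (ℕₚ.m<n⇒0<n∸m m<l))) (*-identityˡ _)))
             (raiseSum-cong (λ _ → refl)
               (λ _ → solve 3 (λ t k f → (t :* k) :* f := k :* (t :* f)) refl _ _ _) ms) ⟩
      (φ (l ∸ m) * τ (l ∸ m)) * (w m * ((τ (l ∸ suc m) * rowWeight l ms) * f (suc m ∷ ms))) +
        raiseSum w (λ ns → rowWeight l ns * (τ (l ∸ m) * f (m ∷ ns))) ms
        ≈⟨ +-congˡ (raiseSum-rowWeight w _ l ms ms<l) ⟩
      _ + rowWeight l ms * raiseSum w′ (λ ns → τ (l ∸ m) * f (m ∷ ns)) ms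
        ≈⟨ +-congˡ (*-congˡ (raiseSum-scale (τ (l ∸ m)) w′ (λ ns → f (m ∷ ns)) ms)) ⟩
      _ + rowWeight l ms * (τ (l ∸ m) * raiseSum w′ (λ ns → f (m ∷ ns)) ms)
        ≈⟨ solve 7 (λ p t w s k f r → (p :* t) :* (w :* ((s :* k) :* f)) :+ k :* (t :* r)
                      := (t :* k) :* ((w :* (p :* s)) :* f :+ r)) refl _ _ _ _ _ _ _ ⟩
      _ ∎
      where
      w′ : ℕ → Carrier
      w′ m = w m * (φ (l ∸ m) * τ (l ∸ suc m))
      raiseSum-scale : ∀ a w f ls → raiseSum w (λ ns → a * f ns) ls ≈ a * raiseSum w f ls
      raiseSum-scale a w f []       = sym (zeroʳ a)
      raiseSum-scale a w f (l ∷ ls) = trans (+-cong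
        (solve 3 (λ w a f → w :* (a :* f) := a :* (w :* f)) refl _ _ _)
        (raiseSum-scale a w _ ls)) (sym (distribˡ _ _ _))

    -- Here the new factor is τ(l - m + 1). A beta number 0 cannot be lowered, and `lowerHead` makes
    -- both sides 0 there.
    lowerSum-rowWeight : ∀ w f l ls → All (_< l) ls →
      lowerSum w (λ ms → rowWeight l ms * f ms) ls ≈
      rowWeight l ls * lowerSum (λ m → w m * (φ (l ∸ m) * τ (suc l ∸ m))) f ls
    lowerSum-rowWeight w f l []       []             = sym (zeroʳ _)
    lowerSum-rowWeight w f l (m ∷ ms) (m<l ∷ ms<l) = begin
      w m * lowerHead (λ ns → rowWeight l ns * f ns) m ms +
        lowerSum w (λ ns → (τ (l ∸ m) * rowWeight l ns) * f (m ∷ ns)) ms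
        ≈⟨ +-cong (trans (*-congˡ (head m m<l))
                         (sym (trans (*-congʳ (φ*τ-pos (ℕₚ.m<n⇒0<n∸m m<l))) (*-identityˡ _))))
             (lowerSum-cong (λ _ → refl)
               (λ _ → solve 3 (λ t k f → (t :* k) :* f := k :* (t :* f)) refl _ _ _) ms) ⟩
      (φ (l ∸ m) * τ (l ∸ m)) * (w m * ((τ (suc l ∸ m) * rowWeight l ms) * lowerHead f m ms)) +
        lowerSum w (λ ns → rowWeight l ns * (τ (l ∸ m) * f (m ∷ ns))) ms
        ≈⟨ +-congˡ (lowerSum-rowWeight w _ l ms ms<l) ⟩
      _ + rowWeight l ms * lowerSum w′ (λ ns → τ (l ∸ m) * f (m ∷ ns)) ms
        ≈⟨ +-congˡ (*-congˡ (lowerSum-scale (τ (l ∸ m)) w′ (λ ns → f (m ∷ ns)) ms)) ⟩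
      _ + rowWeight l ms * (τ (l ∸ m) * lowerSum w′ (λ ns → f (m ∷ ns)) ms)
        ≈⟨ solve 7 (λ p t w s k f r → (p :* t) :* (w :* ((s :* k) :* f)) :+ k :* (t :* r)
                      := (t :* k) :* ((w :* (p :* s)) :* f :+ r)) refl _ _ _ _ _ _ _ ⟩
      _ ∎
      where
      w′ : ℕ → Carrier
      w′ m = w m * (φ (l ∸ m) * τ (suc l ∸ m))
      head : ∀ m → m < l → lowerHead (λ ns → rowWeight l ns * f ns) m ms ≈
                           (τ (suc l ∸ m) * rowWeight l ms) * lowerHead f m ms
      head zero    _ = sym (zeroʳ _)
      head (suc m) _ = refl
      lowerHead-scale : ∀ a f l ls → lowerHead (λ ns → a * f ns) l ls ≈ a * lowerHead f l ls
      lowerHead-scale a f zero    ls = sym (zeroʳ a)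
      lowerHead-scale a f (suc l) ls = refl
      lowerSum-scale : ∀ a w f ls → lowerSum w (λ ns → a * f ns) ls ≈ a * lowerSum w f ls
      lowerSum-scale a w f []       = sym (zeroʳ a)
      lowerSum-scale a w f (l ∷ ls) = trans (+-cong
        (trans (*-congˡ (lowerHead-scale a f l ls))
          (solve 3 (λ w a f → w :* (a :* f) := a :* (w :* f)) refl _ _ _))
        (lowerSum-scale a w _ ls)) (sym (distribˡ _ _ _))

    -- Evaluation of the residue sum over the points of all rows.

    zPow : ℕ → Carrier
    zPow zero    = 1#
    zPow (suc n) = z * zPow n

    τProd : List ℕ → Carrier
    τProd []       = 1#
    τProd (l ∷ ls) = τ l * τProd ls

    -- For each later row m, the point `X (suc m)` contributes φ(l - m), which cancels the old
    -- factor, and `Y m` contributes `z` times the new factor τ(l + 1 - m). The final point `X 0`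
    -- contributes φ(l + 1), which extends `Φ l`.
    rowWeight-raise : ∀ l ls → All (_< l) ls →
      rowWeight l ls * cotProd (X (suc l)) (points ls) ≈ zPow (length ls) * rowWeight (suc l) ls
    rowWeight-raise l [] [] = solve 3 (λ f p o → f :* (p :* o) := o :* (p :* f)) refl _ _ _
    rowWeight-raise l (m ∷ ms) (m<l ∷ ms<l) = begin
      (τ (l ∸ m) * rowWeight l ms) *
        (φ (l ∸ m) * ((z * τ (suc l ∸ m)) * cotProd (X (suc l)) (points ms)))
        ≈⟨ solve 6 (λ t k f z s c → (t :* k) :* (f :* ((z :* s) :* c))
                      := (f :* t) :* ((z :* s) :* (k :* c))) refl _ _ _ _ _ _ ⟩
      (φ (l ∸ m) * τ (l ∸ m)) *
        ((z * τ (suc l ∸ m)) * (rowWeight l ms * cotProd (X (suc l)) (points ms)))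
        ≈⟨ *-cong (φ*τ-pos (ℕₚ.m<n⇒0<n∸m m<l)) (*-congˡ (rowWeight-raise l ms ms<l)) ⟩
      1# * ((z * τ (suc l ∸ m)) * (zPow (length ms) * rowWeight (suc l) ms))
        ≈⟨ *-identityˡ _ ⟩
      (z * τ (suc l ∸ m)) * (zPow (length ms) * rowWeight (suc l) ms)
        ≈⟨ solve 4 (λ z t p k → (z :* t) :* (p :* k) := (z :* p) :* (t :* k)) refl _ _ _ _ ⟩
      _ ∎

    headRowWeight : List ℕ → Carrier
    headRowWeight []       = 0#
    headRowWeight (m ∷ ms) = rowWeight m ms

    -- The roles of the two points of a later row are exchanged. The final point `X 0` now
    -- contributes z τ(l), which strips φ(l) from `Φ l`. This leaves one more `z`, and gives 0 if
    -- `l` is 0.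
    rowWeight-lower : ∀ l ls → All (_< l) ls →
      rowWeight l ls * cotProd (Y l) (points ls) ≈
      zPow (length ls) * (z * lowerHead headRowWeight l ls)
    rowWeight-lower zero    []       [] = begin
      1# * ((z * τ 0) * 1#)    ≈⟨ *-congˡ (trans (*-identityʳ _) (*-congˡ τ-0)) ⟩
      1# * (z * 0#)            ∎
    rowWeight-lower (suc l) []       [] = begin
      (φ (suc l) * Φ l) * ((z * τ (suc l)) * 1#)
        ≈⟨ solve 5 (λ f k z t o → (f :* k) :* ((z :* t) :* o) := (f :* t) :* (o :* (z :* k)))
             refl _ _ _ _ _ ⟩
      (φ (suc l) * τ (suc l)) * (1# * (z * Φ l))
        ≈⟨ trans (*-congʳ (φ*τ l)) (*-identityˡ _) ⟩
      1# * (z * Φ l) ∎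
    rowWeight-lower (suc l) (m ∷ ms) (m<l ∷ ms<l) = begin
      (τ (suc l ∸ m) * rowWeight (suc l) ms) *
        ((z * τ (l ∸ m)) * (φ (suc l ∸ m) * cotProd (Y (suc l)) (points ms)))
        ≈⟨ solve 6 (λ t k z s f c → (t :* k) :* ((z :* s) :* (f :* c))
                      := (f :* t) :* ((z :* s) :* (k :* c))) refl _ _ _ _ _ _ ⟩
      (φ (suc l ∸ m) * τ (suc l ∸ m)) *
        ((z * τ (l ∸ m)) * (rowWeight (suc l) ms * cotProd (Y (suc l)) (points ms)))
        ≈⟨ *-cong (φ*τ-pos (ℕₚ.m<n⇒0<n∸m m<l)) (*-congˡ (rowWeight-lower (suc l) ms ms<l)) ⟩
      1# * ((z * τ (l ∸ m)) * (zPow (length ms) * (z * rowWeight l ms)))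
        ≈⟨ *-identityˡ _ ⟩
      (z * τ (l ∸ m)) * (zPow (length ms) * (z * rowWeight l ms))
        ≈⟨ solve 4 (λ z t p k → (z :* t) :* (p :* (z :* k)) := (z :* p) :* (z :* (t :* k)))
             refl _ _ _ _ ⟩
      (z * zPow (length ms)) * (z * (τ (l ∸ m) * rowWeight l ms)) ∎

    lowerHead-weight : ∀ l ls →
      lowerHead headRowWeight l ls * weight ls ≈ lowerHead weight l ls
    lowerHead-weight zero    ls = zeroˡ _
    lowerHead-weight (suc l) ls = refl

    -- The condition says that the point X 0, to which no row belongs,
    -- contributes nothing.
    weighted-residueSum : ∀ ls → AllPairs _>_ ls → ∀ w → w (X 0) * τProd ls ≈ 0# →
      weight ls * residueSum w (points ls) ≈
      zPow (length ls) * (raiseSum (λ m → w (X (suc m))) weight ls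
                          - z * lowerSum (λ m → w (Y m)) weight ls)
    weighted-residueSum [] _ w w≈0 = begin
      1# * (w (X 0) * 1# + 0#)  ≈⟨ *-congˡ (trans (+-identityʳ _) w≈0) ⟩
      1# * 0#                   ≈⟨ *-congˡ (sym (trans (+-identityˡ _)
                                     (trans (-‿cong (zeroʳ z)) -0#≈0#))) ⟩
      1# * (0# - z * 0#)        ∎
    weighted-residueSum (l ∷ ls) (l>ls ∷ ls!) w w≈0 = begin
      (k * weight ls) * (w x * ((z * τ (suc l ∸ l)) * cotProd x Q)
                         + ((w y * - (z * τ (suc l ∸ l))) * cotProd y Q + residueSum w′ Q))
        -- The two points of a row differ by 1, and `τ 1` is 1, so their mutual factor is `z`.
        ≈⟨ *-congˡ (+-cong (*-congˡ (*-congʳ zτ1)) (+-congʳ (*-congʳ (*-congˡ (-‿cong zτ1))))) ⟩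
      (k * weight ls) * (w x * (z * cotProd x Q) + ((w y * - z) * cotProd y Q + residueSum w′ Q))
        ≈⟨ solve 8 (λ k g wx z cx wy cy s →
                      (k :* g) :* (wx :* (z :* cx) :+ ((wy :* :- z) :* cy :+ s))
                      := (z :* wx) :* ((k :* cx) :* g) :+ ((wy :* :- z) :* ((k :* cy) :* g) :+ k :* (g :* s)))
             refl _ _ _ _ _ _ _ _ ⟩
      (z * w x) * ((k * cotProd x Q) * weight ls) +
        ((w y * - z) * ((k * cotProd y Q) * weight ls) + k * (weight ls * residueSum w′ Q))
        ≈⟨ +-cong (*-congˡ (*-congʳ (rowWeight-raise l ls l>ls)))
             (+-cong (*-congˡ (*-congʳ (rowWeight-lower l ls l>ls)))
                     (*-congˡ (weighted-residueSum ls ls! w′ w′≈0))) ⟩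
      (z * w x) * ((zn * rowWeight (suc l) ls) * weight ls) +
        ((w y * - z) * ((zn * (z * lowered)) * weight ls) + k * (zn * (raised′ - z * lowered′)))
        ≈⟨ solve 9 (λ z wx zn g⁺ wy low gl k d →
                      (z :* wx) :* g⁺ :+ ((wy :* :- z) :* ((zn :* (z :* low)) :* gl) :+ k :* (zn :* d))
                      := (z :* wx) :* g⁺ :+ ((wy :* :- z) :* ((zn :* z) :* (low :* gl)) :+ k :* (zn :* d)))
             refl _ _ _ _ _ _ _ _ _ ⟩
      (z * w x) * ((zn * rowWeight (suc l) ls) * weight ls) +
        ((w y * - z) * ((zn * z) * (lowered * weight ls)) + k * (zn * (raised′ - z * lowered′)))
        ≈⟨ +-congˡ (+-cong (*-congˡ (*-congˡ (lowerHead-weight l ls)))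
             (*-congˡ (*-congˡ (+-cong raised′≈ (-‿cong (*-congˡ lowered′≈)))))) ⟩
      (z * w x) * ((zn * rowWeight (suc l) ls) * weight ls) +
        ((w y * - z) * ((zn * z) * lowerHead weight l ls) + k * (zn * (z * raised″ - z * (z * lowered″))))
        ≈⟨ solve 10 (λ z wx zn k⁺ gl wy gy k r d →
                      (z :* wx) :* ((zn :* k⁺) :* gl) :+
                        ((wy :* :- z) :* ((zn :* z) :* gy) :+ k :* (zn :* (z :* r :- z :* (z :* d))))
                      := (z :* zn) :* ((wx :* (k⁺ :* gl) :+ k :* r) :- z :* (wy :* gy :+ k :* d)))
             refl _ _ _ _ _ _ _ _ _ _ ⟩
      (z * zn) * ((w x * (rowWeight (suc l) ls * weight ls) + k * raised″)
                  - z * (w y * lowerHead weight l ls + k * lowered″))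
        ≈⟨ *-congˡ (+-cong (+-congˡ (raiseSum-rowWeight _ weight l ls l>ls))
             (-‿cong (*-congˡ (+-congˡ (lowerSum-rowWeight _ weight l ls l>ls))))) ⟨
      _ ∎
      where
      x y : Point
      x = X (suc l)
      y = Y l
      Q = points ls
      k = rowWeight l ls
      zn = zPow (length ls)
      lowered = lowerHead headRowWeight l ls
      -- The later points inherit one factor from each point of the first row. For `X (suc m)` and
      -- `Y m` their product is `z` times the factor by which raising or lowering m changes
      -- `rowWeight l`.
      w′ : Point → Carrier
      w′ q = (w q * - cot x q) * - cot y q
      raised′ = raiseSum (λ m → w′ (X (suc m))) weight ls
      lowered′ = lowerSum (λ m → w′ (Y m)) weight ls
      raised″ = raiseSum (λ m → w (X (suc m)) * (φ (l ∸ m) * τ (l ∸ suc m))) weight ls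
      lowered″ = lowerSum (λ m → w (Y m) * (φ (l ∸ m) * τ (suc l ∸ m))) weight ls

      zτ1 : z * τ (suc l ∸ l) ≈ z
      zτ1 = trans (*-congˡ (trans (reflexive (≡.cong τ (ℕₚ.m+n∸n≡m 1 l))) τ-1)) (*-identityʳ z)

      raised′≈ : raised′ ≈ z * raised″
      raised′≈ = trans
        (raiseSum-cong (λ _ → solve 4 (λ w f z t → (w :* :- f) :* :- (z :* t) := z :* (w :* (f :* t)))
           refl _ _ _ _) (λ _ → refl) ls)
        (raiseSum-* z _ weight ls)

      lowered′≈ : lowered′ ≈ z * lowered″
      lowered′≈ = trans
        (lowerSum-cong (λ _ → solve 4 (λ w f z t → (w :* :- (z :* t)) :* :- f := z :* (w :* (f :* t)))
           refl _ _ _ _) (λ _ → refl) ls)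
        (lowerSum-* z _ weight ls)

      -- The factor `cot y (X 0)` is `z * τ l`, and so supplies the `τ l` that `τProd` loses with
      -- the first row.
      w′≈0 : w′ (X 0) * τProd ls ≈ 0#
      w′≈0 = begin
        ((w (X 0) * - φ (suc l)) * - (z * τ l)) * τProd ls
          ≈⟨ solve 5 (λ w f z t p → ((w :* :- f) :* :- (z :* t)) :* p := (f :* z) :* (w :* (t :* p)))
               refl _ _ _ _ _ ⟩
        (φ (suc l) * z) * (w (X 0) * (τ l * τProd ls))
          ≈⟨ *-congˡ w≈0 ⟩
        (φ (suc l) * z) * 0#
          ≈⟨ zeroʳ _ ⟩
        0# ∎

    points-≻ : ∀ {l} ls → All (_< l) ls → All (X (suc l) ≻_) (points ls) × All (Y l ≻_) (points ls)
    points-≻ []       []           = X≻X (s≤s z≤n) ∷ [] , Y≻X z≤n ∷ []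
    points-≻ (m ∷ ms) (m<l ∷ ms<l) with points-≻ ms ms<l
    ... | x≻ , y≻ = X≻X (s≤s m<l) ∷ X≻Y (ℕₚ.m≤n⇒m≤1+n (ℕₚ.<⇒≤ m<l)) ∷ x≻
                  , Y≻X m<l ∷ Y≻Y m<l ∷ y≻

    points-descending : ∀ ls → AllPairs _>_ ls → AllPairs _≻_ (points ls)
    points-descending []       _            = [] ∷ []
    points-descending (l ∷ ls) (l>ls ∷ ls!) with points-≻ ls l>ls
    ... | x≻ , y≻ = (X≻Y (ℕₚ.n≤1+n l) ∷ x≻) ∷ y≻ ∷ points-descending ls ls!

    -- Two points per row and the point `X 0` make an odd number, so the argument on the left is
    -- even and the constant term is a power of `z`, not 0.
    constantTerm-points : ∀ ls → constantTerm (suc (length (points ls))) ≈ zPow (suc (length ls))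
    constantTerm-points []       = refl
    constantTerm-points (l ∷ ls) = *-congˡ (constantTerm-points ls)

    residueSum-points : ∀ ls → AllPairs _>_ ls → residueSum (λ _ → 1#) (points ls) ≈ zPow (length ls)
    residueSum-points []       _  = residueSum-1 (λ {u} {p} {q} → cot-law {u} {p} {q}) (X 0) [] [] []
    residueSum-points (l ∷ ls) l! with points-descending (l ∷ ls) l!
    ... | x≻ ∷ Q! = trans (residueSum-1 (λ {u} {p} {q} → cot-law {u} {p} {q}) _ _ x≻ Q!) (constantTerm-points ls)

    -- The residue sum with unit weights is evaluated twice: by partial fractions, and term by term
    -- as changes of beta numbers. Both values carry the factor `zPow (length ls)`, which is
    -- cancelled.
    raiseSum-lowerSum : (∀ {x y} → z * x ≈ z * y → x ≈ y) →
      ∀ ls → AllPairs _>_ ls → τProd ls ≈ 0# →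
      raiseSum (λ _ → 1#) weight ls ≈ weight ls + z * lowerSum (λ _ → 1#) weight ls
    raiseSum-lowerSum z-cancel ls ls! τ≈0 = begin
      U                ≈⟨ solve 2 (λ u d → u := (u :- d) :+ d) refl _ _ ⟩
      (U - z * V) + z * V ≈⟨ +-congʳ (zPow-cancel (length ls) (begin
        zPow (length ls) * (U - z * V)
          ≈⟨ weighted-residueSum ls ls! (λ _ → 1#) (trans (*-identityˡ _) τ≈0) ⟨
        weight ls * residueSum (λ _ → 1#) (points ls)
          ≈⟨ *-congˡ (residueSum-points ls ls!) ⟩
        weight ls * zPow (length ls)
          ≈⟨ *-comm _ _ ⟩
        zPow (length ls) * weight ls ∎)) ⟩
      weight ls + z * V ∎
      where
      U = raiseSum (λ _ → 1#) weight ls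
      V = lowerSum (λ _ → 1#) weight ls
      zPow-cancel : ∀ n {x y} → zPow n * x ≈ zPow n * y → x ≈ y
      zPow-cancel zero    eq = trans (sym (*-identityˡ _)) (trans eq (*-identityˡ _))
      zPow-cancel (suc n) eq = zPow-cancel n (z-cancel
        (trans (sym (*-assoc _ _ _)) (trans eq (*-assoc _ _ _))))

    -- From beta numbers to adding and removing boxes.

    betaNumbers : List ℕ → List ℕ
    betaNumbers []       = []
    betaNumbers (x ∷ xs) = x ℕ.+ length xs ∷ betaNumbers xs

    partWeight : List ℕ → Carrier
    partWeight xs = weight (betaNumbers xs)

    -- These properties let a sum over all rows of the padded list become a sum over partitions. A
    -- box added below, or removed above, an equal row leaves parts x, x + 1 in this order; their
    -- beta numbers coincide. This is the vanishing case of the straightening rule for Schur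
    -- functions.
    record Straight (f : List ℕ → Carrier) : Set ℓ where
      field
        pad     : ∀ xs → f (xs ∷ʳ 0) ≈ f xs
        vanish : ∀ ws x xs → f (ws ++ x ∷ suc x ∷ xs) ≈ 0#

    open Straight

    straight-∷ : ∀ x {f} → Straight f → Straight (λ xs → f (x ∷ xs))
    straight-∷ x f! .pad xs        = f! .pad (x ∷ xs)
    straight-∷ x f! .vanish ws    = f! .vanish (x ∷ ws)

    -- The lists filtered out by `addOne` are among those on which `f` vanishes, so the filter does
    -- not change the sum.
    addOne-heads : ∀ {f} → Straight f → ∀ x xs → headOr0 xs ≤ x →
      All (λ ys → headOr0 ys ≤ x ⊎ f (x ∷ ys) ≈ 0#) (addOne xs)
    addOne-heads f! zero    []       _   = inj₂ (f! .vanish [] 0 []) ∷ []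
    addOne-heads f! (suc x) []       _   = inj₁ (s≤s z≤n) ∷ []
    addOne-heads f! x       (y ∷ ys) y≤x = first (ℕₚ.m≤n⇒m<n∨m≡n y≤x) ∷ rest (addOne ys)
      where
      first : y < x ⊎ y ≡ x → suc y ≤ x ⊎ _
      first (inj₁ y<x)    = inj₁ y<x
      first (inj₂ ≡.refl) = inj₂ (f! .vanish [] y ys)
      rest : ∀ yss → All (λ ys → headOr0 ys ≤ x ⊎ _) (map (y ∷_) (filter (λ ys → headOr0 ys ℕₚ.≤? y) yss))
      rest yss = Allₚ.map⁺ (All.universal (λ _ → inj₁ y≤x) _)

    -- The induction freezes the first row, whose beta number depends on the number of rows. Hence
    -- `F` and `f` are arbitrary and have to agree only on lists of the padded length.
    raiseSum-addOne : ∀ {xs} → IsPartition xs → ∀ {F f} → Straight f →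
      (∀ ys → length ys ≡ length (xs ∷ʳ 0) → F (betaNumbers ys) ≈ f ys) →
      raiseSum (λ _ → 1#) F (betaNumbers (xs ∷ʳ 0)) ≈ sumOver f (addOne xs)
    raiseSum-addOne {[]}     _  {F} {f} f! F≈f = +-congʳ (trans (*-identityˡ _) (F≈f (1 ∷ []) ≡.refl))
    raiseSum-addOne {x ∷ xs} x∷xs! {F} {f} f! F≈f = begin
      1# * F (betaNumbers (suc x ∷ xs ∷ʳ 0)) + raiseSum (λ _ → 1#) F′ (betaNumbers (xs ∷ʳ 0))
        ≈⟨ +-cong (trans (*-identityˡ _) (F≈f (suc x ∷ xs ∷ʳ 0) ≡.refl))
             (raiseSum-addOne (tail! x∷xs!) (straight-∷ x f!) F′≈) ⟩
      f (suc x ∷ xs ∷ʳ 0) + sumOver (λ ys → f (x ∷ ys)) (addOne xs)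
        ≈⟨ +-cong (f! .pad (suc x ∷ xs))
             (sym (sumOver-filter (λ ys → headOr0 ys ℕₚ.≤? x) (addOne-heads f! x xs (head! x∷xs!)))) ⟩
      f (suc x ∷ xs) + sumOver (λ ys → f (x ∷ ys)) (filter (λ ys → headOr0 ys ℕₚ.≤? x) (addOne xs))
        ≈⟨ +-congˡ (reflexive (sumOver-map f (x ∷_) (filter (λ ys → headOr0 ys ℕₚ.≤? x) (addOne xs)))) ⟨
      sumOver f (addOne (x ∷ xs)) ∎
      where
      F′ : List ℕ → Carrier
      F′ ms = F (x ℕ.+ length (xs ∷ʳ 0) ∷ ms)
      F′≈ : ∀ ys → length ys ≡ length (xs ∷ʳ 0) → F′ (betaNumbers ys) ≈ f (x ∷ ys)
      F′≈ ys eq = trans (reflexive (≡.cong (λ n → F (x ℕ.+ n ∷ betaNumbers ys)) (≡.sym eq)))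
                        (F≈f (x ∷ ys) (≡.cong suc eq))

    lowerSum-removeOne : ∀ {xs} → IsPartition xs → ∀ {F f} → Straight f →
      (∀ ys → length ys ≡ length (xs ∷ʳ 0) → F (betaNumbers ys) ≈ f ys) →
      lowerSum (λ _ → 1#) F (betaNumbers (xs ∷ʳ 0)) ≈ sumOver f (removeOne xs)
    lowerSum-removeOne {[]}         _     {F} {f} f! F≈f = trans (+-identityʳ _) (zeroʳ 1#)
    lowerSum-removeOne {zero ∷ xs}  x∷xs! {F} {f} f! F≈f = contradiction (head-pos x∷xs!) ℕₚ.n≮0
    lowerSum-removeOne {suc x ∷ xs} x∷xs! {F} {f} f! F≈f = begin
      1# * F (betaNumbers (x ∷ xs ∷ʳ 0)) + lowerSum (λ _ → 1#) F′ (betaNumbers (xs ∷ʳ 0))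
        ≈⟨ +-cong (trans (*-identityˡ _) (F≈f (x ∷ xs ∷ʳ 0) ≡.refl))
             (lowerSum-removeOne (tail! x∷xs!) (straight-∷ (suc x) f!) F′≈) ⟩
      f (x ∷ xs ∷ʳ 0) + sumOver (λ ys → f (suc x ∷ ys)) (removeOne xs)
        ≈⟨ +-cong (trans (f! .pad (x ∷ xs)) (corner xs (head! x∷xs!)))
             (reflexive (≡.sym (sumOver-map f (suc x ∷_) (removeOne xs)))) ⟩
      sumOver f (lowerFirst (suc x) xs) + sumOver f (map (suc x ∷_) (removeOne xs))
        ≈⟨ sumOver-++ f (lowerFirst (suc x) xs) _ ⟨
      sumOver f (removeOne (suc x ∷ xs)) ∎
      where
      F′ : List ℕ → Carrier
      F′ ms = F (suc x ℕ.+ length (xs ∷ʳ 0) ∷ ms)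
      F′≈ : ∀ ys → length ys ≡ length (xs ∷ʳ 0) → F′ (betaNumbers ys) ≈ f (suc x ∷ ys)
      F′≈ ys eq = trans (reflexive (≡.cong (λ n → F (suc x ℕ.+ n ∷ betaNumbers ys)) (≡.sym eq)))
                        (F≈f (suc x ∷ ys) (≡.cong suc eq))
      cons≈ : ∀ x xs → f (x ∷ xs) ≈ f (x ∷₀ xs)
      cons≈ zero    []       = f! .pad []
      cons≈ zero    (_ ∷ _)  = refl
      cons≈ (suc _) _        = refl
      -- A row as long as the next one has no removable box. Lowering it all the same puts x
      -- directly before x + 1, where `f` vanishes.
      corner : ∀ xs → headOr0 xs ≤ suc x → f (x ∷ xs) ≈ sumOver f (lowerFirst (suc x) xs)
      corner xs h≤x with headOr0 xs ℕₚ.<? suc x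
      ... | yes _ = trans (cons≈ x xs) (sym (+-identityʳ _))
      corner []       h≤x | no h≮x = contradiction (s≤s z≤n) h≮x
      corner (y ∷ ys) h≤x | no h≮x with ℕₚ.≤-antisym h≤x (ℕₚ.≮⇒≥ h≮x)
      ... | ≡.refl = f! .vanish [] x ys

    -- A row of length 0 raises all other beta numbers by one. The differences stay, and the surplus
    -- φ(l + 1) in `Φ` is cancelled by τ(l + 1), which comes from the new beta number 0.
    rowWeight-pad : ∀ l xs → rowWeight (suc l) (betaNumbers (xs ∷ʳ 0)) ≈ rowWeight l (betaNumbers xs)
    rowWeight-pad l []       = begin
      τ (suc l) * (φ (suc l) * Φ l)  ≈⟨ solve 3 (λ t f k → t :* (f :* k) := (f :* t) :* k) refl _ _ _ ⟩
      (φ (suc l) * τ (suc l)) * Φ l  ≈⟨ trans (*-congʳ (φ*τ l)) (*-identityˡ _) ⟩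
      Φ l                            ∎
    rowWeight-pad l (x ∷ xs) = *-cong (reflexive (≡.cong (λ n → τ (suc l ∸ n))
      (≡.trans (≡.cong (x ℕ.+_) (length-∷ʳ xs)) (ℕₚ.+-suc x (length xs)))))
      (rowWeight-pad l xs)

    partWeight-straight : Straight partWeight
    partWeight-straight .pad []       = *-identityʳ 1#
    partWeight-straight .pad (x ∷ xs) = *-cong
      (trans (reflexive (≡.cong (λ l → rowWeight l (betaNumbers (xs ∷ʳ 0)))
                (≡.trans (≡.cong (x ℕ.+_) (length-∷ʳ xs)) (ℕₚ.+-suc x (length xs)))))
             (rowWeight-pad (x ℕ.+ length xs) xs))
      (partWeight-straight .pad xs)
    partWeight-straight .vanish []       x xs = begin
      (τ (x ℕ.+ suc (length xs) ∸ (suc x ℕ.+ length xs)) * _) * _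
        ≈⟨ *-congʳ (*-congʳ (reflexive (≡.cong τ
             (≡.trans (≡.cong (_∸ (suc x ℕ.+ length xs)) (ℕₚ.+-suc x (length xs)))
                      (ℕₚ.n∸n≡0 (x ℕ.+ length xs)))))) ⟩
      (τ 0 * _) * _  ≈⟨ *-congʳ (trans (*-congʳ τ-0) (zeroˡ _)) ⟩
      0# * _         ≈⟨ zeroˡ _ ⟩
      0#             ∎
    partWeight-straight .vanish (a ∷ ws) x xs =
      trans (*-congˡ (partWeight-straight .vanish ws x xs)) (zeroʳ _)

    betaNumbers-< : ∀ {xs} → IsPartition xs → ∀ x → headOr0 xs ≤ x →
      All (_< x ℕ.+ length (xs ∷ʳ 0)) (betaNumbers (xs ∷ʳ 0))
    betaNumbers-< {[]}     _  x _   = ℕₚ.≤-trans (s≤s z≤n) (ℕₚ.m≤n+m 1 x) ∷ []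
    betaNumbers-< {y ∷ ys} y! x y≤x =
      ℕₚ.+-mono-≤-< y≤x (ℕₚ.n<1+n _) ∷
      All.map (λ b → ℕₚ.<-≤-trans b (ℕₚ.+-mono-≤ y≤x (ℕₚ.n≤1+n _)))
              (betaNumbers-< (tail! y!) y (head! y!))

    betaNumbers-descending : ∀ {xs} → IsPartition xs → AllPairs _>_ (betaNumbers (xs ∷ʳ 0))
    betaNumbers-descending {[]}     _  = [] ∷ []
    betaNumbers-descending {x ∷ xs} x! =
      betaNumbers-< (tail! x!) x (head! x!) ∷ betaNumbers-descending (tail! x!)

    -- The beta number 0 of the appended row provides a factor `τ 0`; this is the condition that
    -- silences the point `X 0`.
    τProd-padded : ∀ xs → τProd (betaNumbers (xs ∷ʳ 0)) ≈ 0#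
    τProd-padded []       = trans (*-identityʳ _) τ-0
    τProd-padded (x ∷ xs) = trans (*-congˡ (τProd-padded xs)) (zeroʳ _)

    addOne-removeOne : (∀ {x y} → z * x ≈ z * y → x ≈ y) → ∀ {xs} → IsPartition xs →
      sumOver partWeight (addOne xs) ≈ partWeight xs + z * sumOver partWeight (removeOne xs)
    addOne-removeOne z-cancel {xs} xs! = begin
      sumOver partWeight (addOne xs)
        ≈⟨ raiseSum-addOne xs! partWeight-straight (λ _ _ → refl) ⟨
      raiseSum (λ _ → 1#) weight (betaNumbers (xs ∷ʳ 0))
        ≈⟨ raiseSum-lowerSum z-cancel _ (betaNumbers-descending xs!) (τProd-padded xs) ⟩
      partWeight (xs ∷ʳ 0) + z * lowerSum (λ _ → 1#) weight (betaNumbers (xs ∷ʳ 0))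
        ≈⟨ +-cong (partWeight-straight .pad xs)
             (*-congˡ (lowerSum-removeOne xs! partWeight-straight (λ _ _ → refl))) ⟩
      partWeight xs + z * sumOver partWeight (removeOne xs) ∎

    -- Hook products in terms of beta numbers.

    ∏ : ℕ → (ℕ → Carrier) → Carrier
    ∏ zero    F = 1#
    ∏ (suc n) F = F 0 * ∏ n (λ i → F (suc i))

    ∏-cong : ∀ n {F G} → (∀ {i} → i < n → F i ≈ G i) → ∏ n F ≈ ∏ n G
    ∏-cong zero    F≈G = refl
    ∏-cong (suc n) F≈G = *-cong (F≈G (s≤s z≤n)) (∏-cong n (λ i<n → F≈G (s≤s i<n)))

    ∏-+ : ∀ m n F → ∏ (m ℕ.+ n) F ≈ ∏ m F * ∏ n (λ i → F (m ℕ.+ i))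
    ∏-+ zero    n F = sym (*-identityˡ _)
    ∏-+ (suc m) n F = trans (*-congˡ (∏-+ m n (λ i → F (suc i)))) (sym (*-assoc _ _ _))

    product-applyUpTo : ∀ (F : ℕ → Carrier) (r : ℕ → ℕ) n →
      foldr _*_ 1# (map F (applyUpTo r n)) ≡ ∏ n (λ i → F (r i))
    product-applyUpTo F r zero    = ≡.refl
    product-applyUpTo F r (suc n) = ≡.cong (F (r 0) *_) (product-applyUpTo F (λ i → r (suc i)) n)

    ∏-singleRow : ∀ n → ∏ n (λ j → φ ((n ∸ suc j) ℕ.+ 0 ℕ.+ 1)) ≈ Φ n
    ∏-singleRow zero    = refl
    ∏-singleRow (suc n) = *-cong
      (reflexive (≡.cong φ (≡.trans (≡.cong (ℕ._+ 1) (ℕₚ.+-identityʳ n)) (ℕₚ.+-comm n 1))))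
      (∏-singleRow n)

    -- The columns from `y` on meet no lower row. Their legs are 0, and their hooks run through e,
    -- ..., 1.
    ∏-firstHook : ∀ y e {xs} → All (_≤ y) xs →
      ∏ (y ℕ.+ e) (λ j → φ (firstHook (y ℕ.+ e) xs j)) ≈
      ∏ y (λ j → φ (firstHook (y ℕ.+ e) xs j)) * Φ e
    ∏-firstHook y e {xs} xs≤y = trans (∏-+ y e _) (*-congˡ (trans
      (∏-cong e (λ {i} _ → reflexive (≡.cong φ (≡.cong₂ (λ a c → a ℕ.+ c ℕ.+ 1)
        (≡.trans (≡.cong (y ℕ.+ e ∸_) (≡.sym (ℕₚ.+-suc y i))) (ℕₚ.[m+n]∸[m+o]≡n∸o y e (suc i)))
        (conj-outside (All.map (λ x≤y → ℕₚ.≤-trans x≤y (ℕₚ.m≤m+n y i)) xs≤y))))))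
      (∏-singleRow e)))

    -- Deleting the second row and lengthening the first by one box trades a unit of leg for a unit
    -- of arm in the columns before `y`. The columns after them change from `Φ e` to `Φ (suc e)`,
    -- where e = x - y, and `τ (suc e)` cancels the additional factor.
    ∏-firstHook-∷ : ∀ {x y ys} → IsPartition (y ∷ ys) → y ≤ x →
      ∏ x (λ j → φ (firstHook x (y ∷ ys) j)) ≈
      τ (suc x ∸ y) * ∏ (suc x) (λ j → φ (firstHook (suc x) ys j))
    ∏-firstHook-∷ {x} {y} {ys} y! y≤x rewrite ≡.sym (ℕₚ.m+[n∸m]≡n y≤x) = begin
      ∏ (y ℕ.+ e) (λ j → φ (firstHook (y ℕ.+ e) (y ∷ ys) j))
        ≈⟨ ∏-firstHook y e (parts-≤ y! ℕₚ.≤-refl) ⟩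
      ∏ y (λ j → φ (firstHook (y ℕ.+ e) (y ∷ ys) j)) * Φ e
        ≈⟨ *-congʳ (∏-cong y (λ j<y → reflexive (≡.cong φ (same j<y)))) ⟩
      ∏ y (λ j → φ (firstHook (y ℕ.+ suc e) ys j)) * Φ e
        ≈⟨ *-congˡ (trans (sym (*-identityˡ _)) (*-congʳ (sym (φ*τ e)))) ⟩
      ∏ y (λ j → φ (firstHook (y ℕ.+ suc e) ys j)) * ((φ (suc e) * τ (suc e)) * Φ e)
        ≈⟨ solve 4 (λ p f t k → p :* ((f :* t) :* k) := t :* (p :* (f :* k))) refl _ _ _ _ ⟩
      τ (suc e) * (∏ y (λ j → φ (firstHook (y ℕ.+ suc e) ys j)) * Φ (suc e))
        ≈⟨ *-congˡ (∏-firstHook y (suc e) (parts-≤ (tail! y!) (head! y!))) ⟨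
      τ (suc e) * ∏ (y ℕ.+ suc e) (λ j → φ (firstHook (y ℕ.+ suc e) ys j))
        ≈⟨ *-cong (reflexive (≡.cong τ (≡.sym (≡.trans (≡.cong (_∸ y) (≡.sym (ℕₚ.+-suc y e)))
             (ℕₚ.m+n∸m≡n y (suc e))))))
             (reflexive (≡.cong (λ n → ∏ n (λ j → φ (firstHook n ys j))) (ℕₚ.+-suc y e))) ⟩
      τ (suc (y ℕ.+ e) ∸ y) * ∏ (suc (y ℕ.+ e)) (λ j → φ (firstHook (suc (y ℕ.+ e)) ys j)) ∎
      where
      e = x ∸ y
      same : ∀ {j} → j < y → firstHook (y ℕ.+ e) (y ∷ ys) j ≡ firstHook (y ℕ.+ suc e) ys j
      same {j} j<y rewrite conj-∷ ys j<y | ℕₚ.+-suc y e | ℕₚ.+-suc (y ℕ.+ e ∸ suc j) (conj ys j)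
        = ≡.cong (λ n → n ℕ.+ conj ys j ℕ.+ 1) (≡.sym (ℕₚ.+-∸-assoc 1
            (ℕₚ.≤-trans j<y (ℕₚ.m≤m+n y e))))

    ∏-firstHook-rowWeight : ∀ {xs} → IsPartition xs → ∀ x → headOr0 xs ≤ x →
      ∏ x (λ j → φ (firstHook x xs j)) ≈ rowWeight (x ℕ.+ length xs) (betaNumbers xs)
    ∏-firstHook-rowWeight {[]}     _  x _   =
      trans (∏-singleRow x) (reflexive (≡.cong Φ (≡.sym (ℕₚ.+-identityʳ x))))
    ∏-firstHook-rowWeight {y ∷ ys} y! x y≤x = begin
      ∏ x (λ j → φ (firstHook x (y ∷ ys) j))
        ≈⟨ ∏-firstHook-∷ y! y≤x ⟩
      τ (suc x ∸ y) * ∏ (suc x) (λ j → φ (firstHook (suc x) ys j))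
        ≈⟨ *-congˡ (∏-firstHook-rowWeight (tail! y!) (suc x)
             (ℕₚ.≤-trans (head! y!) (ℕₚ.m≤n⇒m≤1+n y≤x))) ⟩
      τ (suc x ∸ y) * rowWeight (suc x ℕ.+ length ys) (betaNumbers ys)
        ≈⟨ *-congʳ (reflexive (≡.cong τ (≡.trans
             (≡.cong₂ _∸_ (ℕₚ.+-comm (suc x) (length ys)) (ℕₚ.+-comm y (length ys)))
             (ℕₚ.[m+n]∸[m+o]≡n∸o (length ys) (suc x) y)))) ⟨
      τ (suc x ℕ.+ length ys ∸ (y ℕ.+ length ys)) * rowWeight (suc x ℕ.+ length ys) (betaNumbers ys)
        ≈⟨ reflexive (≡.cong (λ l → rowWeight l (betaNumbers (y ∷ ys))) (ℕₚ.+-suc x (length ys))) ⟨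
      rowWeight (x ℕ.+ suc (length ys)) (betaNumbers (y ∷ ys)) ∎

    product-++ : ∀ xs ys → foldr _*_ 1# (xs ++ ys) ≈ foldr _*_ 1# xs * foldr _*_ 1# ys
    product-++ []       ys = sym (*-identityˡ _)
    product-++ (x ∷ xs) ys = trans (*-congˡ (product-++ xs ys)) (sym (*-assoc _ _ _))

    hookProduct-partWeight : ∀ {xs} → IsPartition xs →
      foldr _*_ 1# (map φ (hooks xs)) ≈ partWeight xs
    hookProduct-partWeight {[]}     _  = refl
    hookProduct-partWeight {x ∷ xs} x! = begin
      foldr _*_ 1# (map φ (hooks (x ∷ xs)))
        ≡⟨ ≡.cong (foldr _*_ 1#) (≡.trans (≡.cong (map φ) (hooks-∷ x!)) (≡.trans
             (map-++ φ (map (firstHook x xs) (upTo x)) (hooks xs))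
             (≡.cong (_++ map φ (hooks xs)) (≡.sym (map-∘ (upTo x)))))) ⟩
      foldr _*_ 1# (map (λ j → φ (firstHook x xs j)) (upTo x) ++ map φ (hooks xs))
        ≈⟨ product-++ (map (λ j → φ (firstHook x xs j)) (upTo x)) _ ⟩
      foldr _*_ 1# (map (λ j → φ (firstHook x xs j)) (upTo x)) * foldr _*_ 1# (map φ (hooks xs))
        ≈⟨ *-cong (trans (reflexive (product-applyUpTo _ (λ j → j) x))
                     (∏-firstHook-rowWeight (tail! x!) x (head! x!)))
             (hookProduct-partWeight (tail! x!)) ⟩
      partWeight (x ∷ xs) ∎

open ℚSolver.+-*-Solver using (solve; _:=_; con)
  renaming (_:+_ to _⊹_; _:*_ to _⊠_; _:-_ to _⊟_)

-- The ring of formal power series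

fromℚᵘ-+ : ∀ p q → fromℚᵘ (p ℚᵘ.+ q) ≡ fromℚᵘ p ℚ.+ fromℚᵘ q
fromℚᵘ-+ p q = ℚₚ.toℚᵘ-injective (ℚᵘₚ.≃-trans (ℚₚ.toℚᵘ-fromℚᵘ (p ℚᵘ.+ q)) (ℚᵘₚ.≃-sym
  (ℚᵘₚ.≃-trans (ℚₚ.toℚᵘ-homo-+ (fromℚᵘ p) (fromℚᵘ q))
    (ℚᵘₚ.+-cong (ℚₚ.toℚᵘ-fromℚᵘ p) (ℚₚ.toℚᵘ-fromℚᵘ q)))))

fromℚᵘ-* : ∀ p q → fromℚᵘ (p ℚᵘ.* q) ≡ fromℚᵘ p ℚ.* fromℚᵘ q
fromℚᵘ-* p q = ℚₚ.toℚᵘ-injective (ℚᵘₚ.≃-trans (ℚₚ.toℚᵘ-fromℚᵘ (p ℚᵘ.* q)) (ℚᵘₚ.≃-sym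
  (ℚᵘₚ.≃-trans (ℚₚ.toℚᵘ-homo-* (fromℚᵘ p) (fromℚᵘ q))
    (ℚᵘₚ.*-cong (ℚₚ.toℚᵘ-fromℚᵘ p) (ℚₚ.toℚᵘ-fromℚᵘ q)))))

integral : ℕ → ℚᵘ.ℚᵘ
integral n = ℚᵘ.mkℚᵘ (+ n) 0

fromℕ-+ : ∀ m n → fromℕ (m ℕ.+ n) ≡ fromℕ m ℚ.+ fromℕ n
fromℕ-+ m n = ≡.trans
  (ℚₚ.fromℚᵘ-cong {integral (m ℕ.+ n)} {integral m ℚᵘ.+ integral n}
    (ℚᵘ.*≡* (≡.cong (ℤ._* + 1) (≡.sym
      (≡.cong₂ ℤ._+_ (ℤₚ.*-identityʳ (+ m)) (ℤₚ.*-identityʳ (+ n)))))))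
  (fromℚᵘ-+ (integral m) (integral n))

fromℕ-* : ∀ m n → fromℕ (m ℕ.* n) ≡ fromℕ m ℚ.* fromℕ n
fromℕ-* m n = ≡.trans
  (ℚₚ.fromℚᵘ-cong {integral (m ℕ.* n)} {integral m ℚᵘ.* integral n}
    (ℚᵘ.*≡* (≡.cong (ℤ._* + 1) (ℤₚ.pos-* m n))))
  (fromℚᵘ-* (integral m) (integral n))

fromℕ*recip : ∀ {n} → 0 < n → fromℕ n ℚ.* recip n ≡ 1ℚ
fromℕ*recip {suc n} _ = ≡.trans (≡.sym (fromℚᵘ-* (integral (suc n)) (ℚᵘ.mkℚᵘ (+ 1) n)))
  (ℚₚ.fromℚᵘ-cong {integral (suc n) ℚᵘ.* ℚᵘ.mkℚᵘ (+ 1) n} {ℚᵘ.1ℚᵘ}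
    (ℚᵘ.*≡* (≡.cong +_ (≡.trans (ℕₚ.*-identityʳ _) (≡.trans (ℕₚ.*-identityʳ _)
      (≡.sym (≡.trans (ℕₚ.*-identityˡ _) (ℕₚ.*-identityˡ _))))))))

sumTo-suc : ∀ k g → sumTo (suc k) g ≡ g 0 ℚ.+ sumTo k (λ i → g (suc i))
sumTo-suc k g = ≡.cong (λ qs → g 0 ℚ.+ foldr ℚ._+_ 0ℚ qs)
  (≡.trans (map-applyUpTo suc g (suc k)) (≡.sym (map-applyUpTo (λ i → i) (λ i → g (suc i)) (suc k))))

sumTo-cong : ∀ k {g h} → (∀ {i} → i ≤ k → g i ≡ h i) → sumTo k g ≡ sumTo k h
sumTo-cong zero    {g} {h} g≡h = ≡.cong (ℚ._+ 0ℚ) (g≡h z≤n)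
sumTo-cong (suc k) {g} {h} g≡h = ≡.trans (sumTo-suc k g) (≡.trans
  (≡.cong₂ ℚ._+_ (g≡h z≤n) (sumTo-cong k (λ i≤k → g≡h (s≤s i≤k)))) (≡.sym (sumTo-suc k h)))

-- The product _*ₛ_, by a recursion that makes the ring laws provable by
-- induction on the exponent.
infixl 7 _⊛_
infixl 6 _⊕_
infix  4 _≋_
_⊛_ : Series → Series → Series
(a ⊛ b) zero    = a 0 ℚ.* b 0
(a ⊛ b) (suc k) = a 0 ℚ.* b (suc k) ℚ.+ ((λ i → a (suc i)) ⊛ b) k

*ₛ≡⊛ : ∀ a b k → (a *ₛ b) k ≡ (a ⊛ b) k
*ₛ≡⊛ a b zero    = ℚₚ.+-identityʳ _
*ₛ≡⊛ a b (suc k) = ≡.trans (sumTo-suc k (λ i → a i ℚ.* b (suc k ∸ i)))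
  (≡.cong (a 0 ℚ.* b (suc k) ℚ.+_) (*ₛ≡⊛ (λ i → a (suc i)) b k))

_⊕_ : Series → Series → Series
(a ⊕ b) k = a k ℚ.+ b k

⊖_ : Series → Series
(⊖ a) k = ℚ.- a k

_≋_ : Series → Series → Set
a ≋ b = ∀ k → a k ≡ b k

constant : ℚ → Series
constant q zero    = q
constant q (suc _) = 0ℚ

⊛-cong : ∀ {a b c d} → a ≋ b → c ≋ d → a ⊛ c ≋ b ⊛ d
⊛-cong a≋b c≋d zero    = ≡.cong₂ ℚ._*_ (a≋b 0) (c≋d 0)
⊛-cong a≋b c≋d (suc k) = ≡.cong₂ ℚ._+_ (≡.cong₂ ℚ._*_ (a≋b 0) (c≋d (suc k)))
                           (⊛-cong (λ i → a≋b (suc i)) c≋d k)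

⊛-distribʳ : ∀ c a b → (a ⊕ b) ⊛ c ≋ a ⊛ c ⊕ b ⊛ c
⊛-distribʳ c a b zero    = ℚₚ.*-distribʳ-+ (c 0) (a 0) (b 0)
⊛-distribʳ c a b (suc k) = ≡.trans (≡.cong ((a 0 ℚ.+ b 0) ℚ.* c (suc k) ℚ.+_)
    (⊛-distribʳ c (λ i → a (suc i)) (λ i → b (suc i)) k))
  (solve 5 (λ a b c d e → (a ⊹ b) ⊠ c ⊹ (d ⊹ e) := (a ⊠ c ⊹ d) ⊹ (b ⊠ c ⊹ e)) ≡.refl
    (a 0) (b 0) (c (suc k)) (((λ i → a (suc i)) ⊛ c) k) (((λ i → b (suc i)) ⊛ c) k))

-- The recursion of `⊛` splits off the constant term of the left factor; commutativity also needs
-- the one of the right factor.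
⊛-sucʳ : ∀ a b k → (a ⊛ b) (suc k) ≡ (a ⊛ (λ i → b (suc i))) k ℚ.+ a (suc k) ℚ.* b 0
⊛-sucʳ a b zero    = ≡.refl
⊛-sucʳ a b (suc k) = ≡.trans (≡.cong (a 0 ℚ.* b (suc (suc k)) ℚ.+_) (⊛-sucʳ (λ i → a (suc i)) b k))
  (≡.sym (ℚₚ.+-assoc (a 0 ℚ.* b (suc (suc k))) _ (a (suc (suc k)) ℚ.* b 0)))

⊛-comm : ∀ a b → a ⊛ b ≋ b ⊛ a
⊛-comm a b zero    = ℚₚ.*-comm (a 0) (b 0)
⊛-comm a b (suc k) = ≡.trans
  (≡.cong₂ ℚ._+_ (ℚₚ.*-comm (a 0) (b (suc k))) (⊛-comm (λ i → a (suc i)) b k))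
  (≡.trans (ℚₚ.+-comm (b (suc k) ℚ.* a 0) _) (≡.sym (⊛-sucʳ b a k)))

⊛-scaleˡ : ∀ q a b → (λ i → q ℚ.* a i) ⊛ b ≋ (λ i → q ℚ.* (a ⊛ b) i)
⊛-scaleˡ q a b zero    = ℚₚ.*-assoc q (a 0) (b 0)
⊛-scaleˡ q a b (suc k) = ≡.trans
  (≡.cong₂ ℚ._+_ (ℚₚ.*-assoc q (a 0) (b (suc k))) (⊛-scaleˡ q (λ i → a (suc i)) b k))
  (≡.sym (ℚₚ.*-distribˡ-+ q (a 0 ℚ.* b (suc k)) _))

⊛-assoc : ∀ a b c → (a ⊛ b) ⊛ c ≋ a ⊛ (b ⊛ c)
⊛-assoc a b c zero    = ℚₚ.*-assoc (a 0) (b 0) (c 0)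
⊛-assoc a b c (suc k) = ≡.trans
  (≡.cong (a 0 ℚ.* b 0 ℚ.* c (suc k) ℚ.+_) (≡.trans
    (⊛-distribʳ c (λ i → a 0 ℚ.* b (suc i)) ((λ i → a (suc i)) ⊛ b) k)
    (≡.cong₂ ℚ._+_ (⊛-scaleˡ (a 0) (λ i → b (suc i)) c k) (⊛-assoc (λ i → a (suc i)) b c k))))
  (solve 5 (λ a b c d e → (a ⊠ b ⊠ c) ⊹ (a ⊠ d ⊹ e) := a ⊠ (b ⊠ c ⊹ d) ⊹ e) ≡.refl
    (a 0) (b 0) (c (suc k)) (((λ i → b (suc i)) ⊛ c) k) (((λ i → a (suc i)) ⊛ (b ⊛ c)) k))

⊛-zeroˡ : ∀ a → (λ _ → 0ℚ) ⊛ a ≋ (λ _ → 0ℚ)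
⊛-zeroˡ a zero    = ℚₚ.*-zeroˡ (a 0)
⊛-zeroˡ a (suc k) = ≡.trans (≡.cong₂ ℚ._+_ (ℚₚ.*-zeroˡ (a (suc k))) (⊛-zeroˡ a k)) (ℚₚ.+-identityˡ 0ℚ)

constant-⊛ : ∀ q a → constant q ⊛ a ≋ (λ i → q ℚ.* a i)
constant-⊛ q a zero    = ≡.refl
constant-⊛ q a (suc k) = ≡.trans (≡.cong (q ℚ.* a (suc k) ℚ.+_) (⊛-zeroˡ a k)) (ℚₚ.+-identityʳ _)

oneₛ≋constant : oneₛ ≋ constant 1ℚ
oneₛ≋constant zero    = ≡.refl
oneₛ≋constant (suc _) = ≡.refl

⊛-identityˡ : ∀ a → oneₛ ⊛ a ≋ a
⊛-identityˡ a k = ≡.trans (⊛-cong oneₛ≋constant (λ _ → ≡.refl) k)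
  (≡.trans (constant-⊛ 1ℚ a k) (ℚₚ.*-identityˡ (a k)))

seriesRing : CommutativeRing _ _
seriesRing = record
  { Carrier = Series
  ; _≈_ = _≋_
  ; _+_ = _⊕_
  ; _*_ = _⊛_
  ; -_  = ⊖_
  ; 0#  = λ _ → 0ℚ
  ; 1#  = oneₛ
  ; isCommutativeRing = record
    { isRing = record
      { +-isAbelianGroup = record
        { isGroup = record
          { isMonoid = record
            { isSemigroup = record
              { isMagma = record
                { isEquivalence = record
                  { refl  = λ _ → ≡.refl
                  ; sym   = λ a≋b k → ≡.sym (a≋b k)
                  ; trans = λ a≋b b≋c k → ≡.trans (a≋b k) (b≋c k)
                  }
                ; ∙-cong = λ a≋b c≋d k → ≡.cong₂ ℚ._+_ (a≋b k) (c≋d k)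
                }
              ; assoc = λ a b c k → ℚₚ.+-assoc (a k) (b k) (c k)
              }
            ; identity = (λ a k → ℚₚ.+-identityˡ (a k)) , (λ a k → ℚₚ.+-identityʳ (a k))
            }
          ; inverse = (λ a k → ℚₚ.+-inverseˡ (a k)) , (λ a k → ℚₚ.+-inverseʳ (a k))
          ; ⁻¹-cong = λ a≋b k → ≡.cong ℚ.-_ (a≋b k)
          }
        ; comm = λ a b k → ℚₚ.+-comm (a k) (b k)
        }
      ; *-cong = ⊛-cong
      ; *-assoc = ⊛-assoc
      ; *-identity = ⊛-identityˡ , (λ a k → ≡.trans (⊛-comm a oneₛ k) (⊛-identityˡ a k))
      ; distrib = (λ a b c k → ≡.trans (⊛-comm a (b ⊕ c) k) (≡.trans (⊛-distribʳ a b c k)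
                    (≡.cong₂ ℚ._+_ (⊛-comm b a k) (⊛-comm c a k))))
                , ⊛-distribʳ
      }
    ; *-comm = ⊛-comm
    }
  }

constantHom : CommutativeRing.rawRing ℚₚ.+-*-commutativeRing
                -Raw-AlmostCommutative⟶ fromCommutativeRing seriesRing
constantHom = record
  { ⟦_⟧    = constant
  ; +-homo = λ { p q zero → ≡.refl ; p q (suc k) → ≡.sym (ℚₚ.+-identityˡ 0ℚ) }
  ; *-homo = λ { p q zero → ≡.refl
               ; p q (suc k) → ≡.sym (≡.trans (constant-⊛ p (constant q) (suc k)) (ℚₚ.*-zeroʳ p)) }
  ; -‿homo = λ { p zero → ≡.refl ; p (suc k) → ≡.refl }
  ; 0-homo = λ { zero → ≡.refl ; (suc k) → ≡.refl }
  ; 1-homo = λ k → ≡.sym (oneₛ≋constant k)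
  }

-- Division of power series, by the scheme of `ρList` with arbitrary numerator and denominator.

quotientList : Series → Series → ℚ → ℕ → List ℚ
quotientList a b c zero    = a 0 ℚ.* c ∷ []
quotientList a b c (suc k) =
  qs ++ (a (suc k) ℚ.- sumTo k (λ i → b (suc i) ℚ.* nth (reverse qs) i)) ℚ.* c ∷ []
  where qs = quotientList a b c k

quotient : Series → Series → ℚ → Series
quotient a b c k = nth (quotientList a b c k) k

nth-++ : ∀ {k} qs q → length qs ≡ k → nth (qs ++ q ∷ []) k ≡ q
nth-++ []       q ≡.refl = ≡.refl
nth-++ (x ∷ qs) q ≡.refl = nth-++ qs q ≡.refl

nth-applyDownFrom : ∀ (g : ℕ → ℚ) k {i} → i ≤ k → nth (applyDownFrom g (suc k)) i ≡ g (k ∸ i)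
nth-applyDownFrom g k       z≤n       = ≡.refl
nth-applyDownFrom g (suc k) (s≤s i≤k) = nth-applyDownFrom g k i≤k

module _ (a b : Series) (c : ℚ) (b₀c≡1 : b 0 ℚ.* c ≡ 1ℚ) where

  private
    q : Series
    q = quotient a b c

  -- Each list extends the preceding one, so the entries read back by the recursion are true
  -- coefficients of the quotient.
  quotientList-applyUpTo : ∀ k → quotientList a b c k ≡ applyUpTo q (suc k)
  quotientList-applyUpTo zero    = ≡.refl
  quotientList-applyUpTo (suc k) = ≡.trans
    (≡.cong₂ (λ qs x → qs ++ x ∷ []) (quotientList-applyUpTo k)
      (≡.sym (nth-++ (quotientList a b c k) _
        (≡.trans (≡.cong length (quotientList-applyUpTo k)) (length-applyUpTo q (suc k))))))
    (applyUpTo-∷ʳ q (suc k))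

  -- Reversing the list puts coefficient k - i at position `i`, which makes the sum in the recursion
  -- a convolution.
  quotient-suc : ∀ k → q (suc k) ≡ (a (suc k) ℚ.- ((λ i → b (suc i)) ⊛ q) k) ℚ.* c
  quotient-suc k = ≡.trans
    (nth-++ (quotientList a b c k) _
      (≡.trans (≡.cong length (quotientList-applyUpTo k)) (length-applyUpTo q (suc k))))
    (≡.cong (λ t → (a (suc k) ℚ.- t) ℚ.* c) (≡.trans
      (sumTo-cong k (λ {i} i≤k → ≡.cong (b (suc i) ℚ.*_) (≡.trans
        (≡.cong (λ qs → nth qs i) (≡.trans (≡.cong reverse (quotientList-applyUpTo k))
                                           (reverse-applyUpTo q (suc k))))
        (nth-applyDownFrom q k i≤k))))
      (*ₛ≡⊛ (λ i → b (suc i)) q k)))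

  ⊛-quotient : b ⊛ q ≋ a
  ⊛-quotient zero    = ≡.trans (solve 3 (λ a b c → b ⊠ (a ⊠ c) := (b ⊠ c) ⊠ a) ≡.refl (a 0) (b 0) c)
    (≡.trans (≡.cong (ℚ._* a 0) b₀c≡1) (ℚₚ.*-identityˡ (a 0)))
  ⊛-quotient (suc k) = ≡.trans
    (≡.cong (λ x → b 0 ℚ.* x ℚ.+ t) (quotient-suc k)) (≡.trans
    (solve 4 (λ a b c t → b ⊠ ((a ⊟ t) ⊠ c) ⊹ t := (b ⊠ c) ⊠ (a ⊟ t) ⊹ t) ≡.refl (a (suc k)) (b 0) c t)
    (≡.trans (≡.cong (λ x → x ℚ.* (a (suc k) ℚ.- t) ℚ.+ t) b₀c≡1)
    (solve 2 (λ a t → con 1ℚ ⊠ (a ⊟ t) ⊹ t := a) ≡.refl (a (suc k)) t)))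
    where t = ((λ i → b (suc i)) ⊛ q) k

-- (1 + √z)ʰ = evenPart h + √z · denρ h
evenPart : ℕ → Series
evenPart h k = fromℕ (h C (2 ℕ.* k))

zₛ : Series
zₛ zero    = 0ℚ
zₛ (suc k) = oneₛ k

zₛ-⊛-zero : ∀ a → (zₛ ⊛ a) 0 ≡ 0ℚ
zₛ-⊛-zero a = ℚₚ.*-zeroˡ (a 0)

zₛ-⊛-suc : ∀ a k → (zₛ ⊛ a) (suc k) ≡ a k
zₛ-⊛-suc a k = ≡.trans (≡.cong₂ ℚ._+_ (ℚₚ.*-zeroˡ (a (suc k))) (⊛-identityˡ a k)) (ℚₚ.+-identityˡ (a k))

zₛ-cancel : ∀ {a b} → zₛ ⊛ a ≋ zₛ ⊛ b → a ≋ b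
zₛ-cancel {a} {b} eq k = ≡.trans (≡.sym (zₛ-⊛-suc a k)) (≡.trans (eq (suc k)) (zₛ-⊛-suc b k))

denρ-0 : denρ 0 ≋ (λ _ → 0ℚ)
denρ-0 k = ≡.refl

evenPart-0 : evenPart 0 ≋ oneₛ
evenPart-0 zero    = ≡.refl
evenPart-0 (suc k) = ≡.refl

denρ-suc : ∀ h → denρ (suc h) ≋ evenPart h ⊕ denρ h
denρ-suc h k = ≡.trans (≡.cong fromℕ (≡.sym (nCk+nC[k+1]≡[n+1]C[k+1] h (2 ℕ.* k))))
  (fromℕ-+ (h C (2 ℕ.* k)) (h C suc (2 ℕ.* k)))

evenPart-suc : ∀ h → evenPart (suc h) ≋ evenPart h ⊕ zₛ ⊛ denρ h
evenPart-suc h zero    = ≡.sym (≡.trans (≡.cong (evenPart h 0 ℚ.+_) (zₛ-⊛-zero (denρ h)))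
  (ℚₚ.+-identityʳ (evenPart h 0)))
evenPart-suc h (suc k) = ≡.trans
  (≡.cong fromℕ (≡.trans (≡.cong (suc h C_) (2*suc k)) (≡.trans
    (≡.sym (nCk+nC[k+1]≡[n+1]C[k+1] h (suc (2 ℕ.* k))))
    (≡.trans (ℕₚ.+-comm (h C suc (2 ℕ.* k)) _) (≡.cong (λ n → h C n ℕ.+ h C suc (2 ℕ.* k)) (≡.sym (2*suc k)))))))
  (≡.trans (fromℕ-+ (h C (2 ℕ.* suc k)) (h C suc (2 ℕ.* k)))
    (≡.cong (evenPart h (suc k) ℚ.+_) (≡.sym (zₛ-⊛-suc (denρ h) k))))
  where
  2*suc : ∀ k → 2 ℕ.* suc k ≡ suc (suc (2 ℕ.* k))
  2*suc k = ≡.cong suc (ℕₚ.+-suc k (k ℕ.+ 0))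

-- The argument `1ℚ` is the inverse of the constant coefficient of `evenPart h`, which is 1 for
-- every `h`, including 0.
φₛ τₛ : ℕ → Series
φₛ h k = recip h ℚ.* ρ h k
τₛ h = quotient (denρ h) (evenPart h) 1ℚ

evenPart*τₛ : ∀ h → evenPart h ⊛ τₛ h ≋ denρ h
evenPart*τₛ h = ⊛-quotient (denρ h) (evenPart h) 1ℚ ≡.refl

ρ-quotient : ∀ h → ρ h ≋ quotient (numρ h) (denρ h) (recip (h C 1))
ρ-quotient h k = ≡.cong (λ qs → nth qs k) (list k)
  where
  list : ∀ k → ρList h k ≡ quotientList (numρ h) (denρ h) (recip (h C 1)) k
  list zero    = ≡.refl
  list (suc k) = ≡.cong (λ qs → qs ++ (numρ h (suc k) ℚ.-
    sumTo k (λ i → denρ h (suc i) ℚ.* nth (reverse qs) i)) ℚ.* recip (h C 1) ∷ []) (list k)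

denρ*φₛ : ∀ n → denρ (suc n) ⊛ φₛ (suc n) ≋ evenPart (suc n)
denρ*φₛ n k = begin
  (denρ h ⊛ φₛ h) k                       ≡⟨ ⊛-comm (denρ h) (φₛ h) k ⟩
  (φₛ h ⊛ denρ h) k                       ≡⟨ ⊛-scaleˡ (recip h) (ρ h) (denρ h) k ⟩
  recip h ℚ.* (ρ h ⊛ denρ h) k            ≡⟨ ≡.cong (recip h ℚ.*_) (⊛-comm (ρ h) (denρ h) k) ⟩
  recip h ℚ.* (denρ h ⊛ ρ h) k            ≡⟨ ≡.cong (recip h ℚ.*_) (≡.trans
                                               (⊛-cong {denρ h} (λ _ → ≡.refl) (ρ-quotient h) k)
                                               (⊛-quotient (numρ h) (denρ h) (recip (h C 1)) h-unit k)) ⟩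
  recip h ℚ.* numρ h k                    ≡⟨ ≡.cong (recip h ℚ.*_) (fromℕ-* h (h C (2 ℕ.* k))) ⟩
  recip h ℚ.* (fromℕ h ℚ.* evenPart h k)  ≡⟨ ℚₚ.*-assoc (recip h) (fromℕ h) (evenPart h k) ⟨
  recip h ℚ.* fromℕ h ℚ.* evenPart h k    ≡⟨ ≡.cong (ℚ._* evenPart h k)
                                               (≡.trans (ℚₚ.*-comm (recip h) (fromℕ h)) (fromℕ*recip {h} (s≤s z≤n))) ⟩
  1ℚ ℚ.* evenPart h k                     ≡⟨ ℚₚ.*-identityˡ (evenPart h k) ⟩
  evenPart h k                            ∎
  where
  open ≡.≡-Reasoning
  h : ℕ
  h = suc n
  h-unit : denρ h 0 ℚ.* recip (h C 1) ≡ 1ℚ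
  h-unit = fromℕ*recip {h C 1} (≡.subst (0 <_) (≡.sym (nC1≡n h)) (s≤s z≤n))

module SeriesAlgebra = ℚAlgebra seriesRing constantHom

module HyperbolicSeries = SeriesAlgebra.Hyperbolic zₛ evenPart denρ (λ h → quotient oneₛ (evenPart h) 1ℚ)
  φₛ τₛ evenPart-0 denρ-0 evenPart-suc denρ-suc
  (λ h → ⊛-quotient oneₛ (evenPart h) 1ℚ ≡.refl) denρ*φₛ evenPart*τₛ

open SeriesAlgebra.HookProducts zₛ φₛ τₛ HyperbolicSeries.τ-0 HyperbolicSeries.τ-1
  HyperbolicSeries.φ*τ HyperbolicSeries.τ-add
  using (partWeight; hookProduct-partWeight; addOne-removeOne)

-- Adding and removing boxes

open Sums ℚₚ.+-*-commutativeRing using () renaming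
  ( sumOver to ∑; sumOver-map to ∑-map; sumOver-cong to ∑-cong; sumOver-0 to ∑-0; sumOver-+ to ∑-+
  ; sumOver-* to ∑-*; sumOver-++ to ∑-++; sumOver-concatMap to ∑-concatMap; sumOver-swap to ∑-swap
  ; sumOver-filter to ∑-filter; sumOver-applyUpTo to ∑-applyUpTo)

∑-congᵤ : ∀ {x} {X : Set x} {f g : X → ℚ} → (∀ x → f x ≡ g x) → ∀ xs → ∑ f xs ≡ ∑ g xs
∑-congᵤ f≡g xs = ∑-cong (All.universal f≡g xs)

∷! : ∀ {x xs} → 0 < x → headOr0 xs ≤ x → IsPartition xs → IsPartition (x ∷ xs)
∷! 0<x _   nil               = one 0<x
∷! _   y≤x y!@(one _)        = cons y≤x y!
∷! _   y≤x y!@(cons _ _)     = cons y≤x y!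

head<1⇒[] : ∀ {xs} → IsPartition xs → headOr0 xs < 1 → xs ≡ []
head<1⇒[] nil            _         = ≡.refl
head<1⇒[] (one 0<x)      (s≤s x≤0) = contradiction 0<x (ℕₚ.≤⇒≯ x≤0)
head<1⇒[] y!@(cons _ _)  (s≤s x≤0) = contradiction (head-pos y!) (ℕₚ.≤⇒≯ x≤0)

addOne-partition : ∀ {xs} → IsPartition xs → All IsPartition (addOne xs)
addOne-partition {[]}     _  = one (s≤s z≤n) ∷ []
addOne-partition {x ∷ xs} x! =
  ∷! (s≤s z≤n) (ℕₚ.m≤n⇒m≤1+n (head! x!)) (tail! x!) ∷
  Allₚ.map⁺ (All.zipWith (λ (ys≤x , ys!) → ∷! (head-pos x!) ys≤x ys!)
    ( Allₚ.all-filter (λ ys → headOr0 ys ℕₚ.≤? x) (addOne xs)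
    , Allₚ.filter⁺ (λ ys → headOr0 ys ℕₚ.≤? x) (addOne-partition (tail! x!))))

addOne-head-≥ : ∀ xs → All (λ ys → headOr0 xs ≤ headOr0 ys) (addOne xs)
addOne-head-≥ []       = z≤n ∷ []
addOne-head-≥ (x ∷ xs) = ℕₚ.n≤1+n x ∷ Allₚ.map⁺ (All.universal (λ _ → ℕₚ.≤-refl) _)

addOne-head-≤ : ∀ xs → All (λ ys → headOr0 ys ≤ suc (headOr0 xs)) (addOne xs)
addOne-head-≤ []       = s≤s z≤n ∷ []
addOne-head-≤ (x ∷ xs) = ℕₚ.≤-refl ∷ Allₚ.map⁺ (All.universal (λ _ → ℕₚ.n≤1+n x) _)

lowerFirst-partition : ∀ {x xs} → IsPartition (x ∷ xs) → All IsPartition (lowerFirst x xs)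
lowerFirst-partition {x} {xs} x! with headOr0 xs ℕₚ.<? x
... | no _    = []
... | yes h<x = lower x! h<x ∷ []
  where
  lower : ∀ {x xs} → IsPartition (x ∷ xs) → headOr0 xs < x → IsPartition (pred x ∷₀ xs)
  lower {zero}        x! h<x       = contradiction h<x ℕₚ.n≮0
  lower {suc zero}    x! h<x       rewrite head<1⇒[] (tail! x!) h<x = nil
  lower {suc (suc x)} x! (s≤s h≤x) = ∷! (s≤s z≤n) h≤x (tail! x!)

lowerFirst-head : ∀ x xs → All (λ ys → headOr0 ys ≤ x) (lowerFirst x xs)
lowerFirst-head x xs with headOr0 xs ℕₚ.<? x
... | no _    = []
... | yes h<x = lower x xs h<x ∷ []
  where
  lower : ∀ x xs → headOr0 xs < x → headOr0 (pred x ∷₀ xs) ≤ x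
  lower (suc zero)    []       _ = z≤n
  lower (suc zero)    (_ ∷ _)  _ = z≤n
  lower (suc (suc x)) xs       _ = ℕₚ.n≤1+n (suc x)

removeOne-head : ∀ xs → All (λ ys → headOr0 ys ≤ headOr0 xs) (removeOne xs)
removeOne-head []       = []
removeOne-head (x ∷ xs) = Allₚ.++⁺ (lowerFirst-head x xs)
  (Allₚ.map⁺ (All.universal (λ _ → ℕₚ.≤-refl) (removeOne xs)))

removeOne-partition : ∀ {xs} → IsPartition xs → All IsPartition (removeOne xs)
removeOne-partition {[]}     _  = []
removeOne-partition {x ∷ xs} x! = Allₚ.++⁺ (lowerFirst-partition x!)
  (Allₚ.map⁺ (All.zipWith (λ (ys≤ , ys!) → ∷! (head-pos x!) (ℕₚ.≤-trans ys≤ (head! x!)) ys!)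
    (removeOne-head xs , removeOne-partition (tail! x!))))

up down : (List ℕ → ℚ) → List ℕ → ℚ
up   g xs = ∑ g (addOne xs)
down g xs = ∑ g (removeOne xs)

-- Below a row of length `b`, `addOne` keeps only lists with head at most `b`. An induction on rows
-- thus meets this bounded sum in place of `up`.
up≤ : ℕ → (List ℕ → ℚ) → List ℕ → ℚ
up≤ b g xs = ∑ g (filter (λ ys → headOr0 ys ℕₚ.≤? b) (addOne xs))

when : ∀ {p} {P : Set p} → Dec P → ℚ → ℚ
when (yes _) q = q
when (no _)  q = 0ℚ

when-yes : ∀ {p} {P : Set p} (P? : Dec P) {q} → P → when P? q ≡ q
when-yes (yes _) p = ≡.refl
when-yes (no ¬p) p = contradiction p ¬p

when-+ : ∀ {p} {P : Set p} (P? : Dec P) q r → when P? (q ℚ.+ r) ≡ when P? q ℚ.+ when P? r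
when-+ (yes _) q r = ≡.refl
when-+ (no _)  q r = ≡.refl

∑-filter-∷ : ∀ {x p} {X : Set x} {P : X → Set p} (P? : ∀ x → Dec (P x)) f x xs →
  ∑ f (filter P? (x ∷ xs)) ≡ when (P? x) (f x) ℚ.+ ∑ f (filter P? xs)
∑-filter-∷ P? f x xs with P? x
... | yes _ = ≡.refl
... | no _  = ≡.sym (ℚₚ.+-identityˡ _)

up≤-[] : ∀ b g → up≤ b g [] ≡ when (1 ℕₚ.≤? b) (g (1 ∷ []))
up≤-[] b g = ≡.trans (∑-filter-∷ (λ ys → headOr0 ys ℕₚ.≤? b) g (1 ∷ []) []) (ℚₚ.+-identityʳ _)

up≤-∷ : ∀ {b x} g xs → x ≤ b →
  up≤ b g (x ∷ xs) ≡ when (suc x ℕₚ.≤? b) (g (suc x ∷ xs)) ℚ.+ up≤ x (λ ys → g (x ∷ ys)) xs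
up≤-∷ {b} {x} g xs x≤b = ≡.trans
  (∑-filter-∷ (λ ys → headOr0 ys ℕₚ.≤? b) g (suc x ∷ xs) (map (x ∷_) kept))
  (≡.cong (when (suc x ℕₚ.≤? b) (g (suc x ∷ xs)) ℚ.+_) (≡.trans
    (≡.cong (∑ g) (filter-all (λ ys → headOr0 ys ℕₚ.≤? b) (Allₚ.map⁺ (All.universal (λ _ → x≤b) kept))))
    (∑-map g (x ∷_) kept)))
  where
  kept : List (List ℕ)
  kept = filter (λ ys → headOr0 ys ℕₚ.≤? x) (addOne xs)

up≡up≤ : ∀ {b} g xs → headOr0 xs < b → up g xs ≡ up≤ b g xs
up≡up≤ {b} g xs h<b = ≡.cong (∑ g) (≡.sym (filter-all (λ ys → headOr0 ys ℕₚ.≤? b)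
  (All.map (λ h≤ → ℕₚ.≤-trans h≤ h<b) (addOne-head-≤ xs))))

up≤-+ : ∀ b g h xs → up≤ b (λ ys → g ys ℚ.+ h ys) xs ≡ up≤ b g xs ℚ.+ up≤ b h xs
up≤-+ b g h xs = ∑-+ g h (filter (λ ys → headOr0 ys ℕₚ.≤? b) (addOne xs))

-- After a box is added below a row of length x + 1, that row can lose a box only if the new head is
-- at most x. This is the same bound as when the row is shortened before the addition.
up≤-when : ∀ x g xs → up≤ (suc x) (λ ys → when (headOr0 ys ℕₚ.<? suc x) (g ys)) xs ≡ up≤ x g xs
up≤-when x g xs = go (addOne xs)
  where
  go : ∀ yss → ∑ (λ ys → when (headOr0 ys ℕₚ.<? suc x) (g ys)) (filter (λ ys → headOr0 ys ℕₚ.≤? suc x) yss)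
             ≡ ∑ g (filter (λ ys → headOr0 ys ℕₚ.≤? x) yss)
  go []         = ≡.refl
  go (ys ∷ yss) = ≡.trans
    (∑-filter-∷ (λ ys → headOr0 ys ℕₚ.≤? suc x) _ ys yss) (≡.trans
    (≡.cong₂ ℚ._+_ (both (headOr0 ys ℕₚ.≤? suc x) (headOr0 ys ℕₚ.<? suc x) (headOr0 ys ℕₚ.≤? x)) (go yss))
    (≡.sym (∑-filter-∷ (λ ys → headOr0 ys ℕₚ.≤? x) g ys yss)))
    where
    both : ∀ {h q} (c : Dec (h ≤ suc x)) (d : Dec (h < suc x)) (e : Dec (h ≤ x)) →
      when c (when d q) ≡ when e q
    both (yes _)    (yes _)         (yes _)   = ≡.refl
    both (yes _)    (no h≮)         (yes h≤x) = contradiction (s≤s h≤x) h≮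
    both (no h≰)    _               (yes h≤x) = contradiction (ℕₚ.m≤n⇒m≤1+n h≤x) h≰
    both (yes _)    (yes (s≤s h≤x)) (no h≰x)  = contradiction h≤x h≰x
    both (yes _)    (no _)          (no _)    = ≡.refl
    both (no _)     _               (no _)    = ≡.refl

up≤-full : ∀ x g xs → x < headOr0 xs → up≤ x g xs ≡ 0ℚ
up≤-full x g xs x<h = ≡.cong (∑ g) (filter-none (λ ys → headOr0 ys ℕₚ.≤? x)
  (All.map (λ h≤ → ℕₚ.<⇒≱ (ℕₚ.<-≤-trans x<h h≤)) (addOne-head-≥ xs)))

down-∷ : ∀ g x xs → down g (x ∷ xs) ≡
  when (headOr0 xs ℕₚ.<? x) (g (pred x ∷₀ xs)) ℚ.+ down (λ ys → g (x ∷ ys)) xs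
down-∷ g x xs = ≡.trans (∑-++ g (lowerFirst x xs) (map (x ∷_) (removeOne xs)))
  (≡.cong₂ ℚ._+_ first (∑-map g (x ∷_) (removeOne xs)))
  where
  first : ∑ g (lowerFirst x xs) ≡ when (headOr0 xs ℕₚ.<? x) (g (pred x ∷₀ xs))
  first with headOr0 xs ℕₚ.<? x
  ... | yes _ = ℚₚ.+-identityʳ _
  ... | no _  = ≡.refl

-- A box can be added to the first row exactly when that row is shorter than b;
-- every other addable box of a partition pairs with the removable box of the
-- row above it.
up≤-down : ∀ b g {xs} → IsPartition xs → headOr0 xs ≤ b →
  up≤ b (down g) xs ≡ down (up≤ b g) xs ℚ.+ when (headOr0 xs ℕₚ.<? b) (g xs)
up≤-down b g {[]} _ _ = ≡.trans (up≤-[] b (down g)) (≡.trans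
  (≡.cong (when (1 ℕₚ.≤? b)) (≡.trans (down-∷ g 1 []) (ℚₚ.+-identityʳ _)))
  (≡.sym (ℚₚ.+-identityˡ _)))
up≤-down b g {zero ∷ xs}  x! x≤b = contradiction (head-pos x!) ℕₚ.n≮0
up≤-down b g {suc p ∷ xs} x! x≤b = begin
  up≤ b (down g) (x ∷ xs)
    ≡⟨ up≤-∷ (down g) xs x≤b ⟩
  W (down g (suc x ∷ xs)) ℚ.+ up≤ x (λ ys → down g (x ∷ ys)) xs
    ≡⟨ ≡.cong₂ (λ q r → W q ℚ.+ r)
         (≡.trans (down-∷ g (suc x) xs)
           (≡.cong (ℚ._+ down gₛₓ xs) (when-yes (headOr0 xs ℕₚ.<? suc x) (s≤s (head! x!)))))
         (∑-congᵤ (down-∷ g x) (filter (λ ys → headOr0 ys ℕₚ.≤? x) (addOne xs))) ⟩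
  W (g (x ∷ xs) ℚ.+ down gₛₓ xs) ℚ.+
    up≤ x (λ ys → when (headOr0 ys ℕₚ.<? x) (gₚ ys) ℚ.+ down gₓ ys) xs
    ≡⟨ ≡.cong₂ ℚ._+_ (when-+ (suc x ℕₚ.≤? b) (g (x ∷ xs)) (down gₛₓ xs))
         (up≤-+ x (λ ys → when (headOr0 ys ℕₚ.<? x) (gₚ ys)) (down gₓ) xs) ⟩
  (W (g (x ∷ xs)) ℚ.+ W (down gₛₓ xs)) ℚ.+
    (up≤ x (λ ys → when (headOr0 ys ℕₚ.<? x) (gₚ ys)) xs ℚ.+ up≤ x (down gₓ) xs)
    ≡⟨ ≡.cong ((W (g (x ∷ xs)) ℚ.+ W (down gₛₓ xs)) ℚ.+_)
         (≡.cong₂ ℚ._+_ (up≤-when p gₚ xs) (up≤-down x gₓ (tail! x!) (head! x!))) ⟩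
  (W (g (x ∷ xs)) ℚ.+ W (down gₛₓ xs)) ℚ.+
    (up≤ p gₚ xs ℚ.+ (down (up≤ x gₓ) xs ℚ.+ when (headOr0 xs ℕₚ.<? x) (g (x ∷ xs))))
    ≡⟨ solve 5 (λ w d u v k → (w ⊹ d) ⊹ (u ⊹ (v ⊹ k)) := ((k ⊹ u) ⊹ (d ⊹ v)) ⊹ w) ≡.refl
         (W (g (x ∷ xs))) (W (down gₛₓ xs)) (up≤ p gₚ xs) (down (up≤ x gₓ) xs)
         (when (headOr0 xs ℕₚ.<? x) (g (x ∷ xs))) ⟩
  ((when (headOr0 xs ℕₚ.<? x) (g (x ∷ xs)) ℚ.+ up≤ p gₚ xs) ℚ.+ (W (down gₛₓ xs) ℚ.+ down (up≤ x gₓ) xs))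
    ℚ.+ W (g (x ∷ xs))
    ≡⟨ ≡.cong (ℚ._+ W (g (x ∷ xs))) (≡.cong₂ ℚ._+_ first (≡.sym rest)) ⟩
  (when (headOr0 xs ℕₚ.<? x) (up≤ b g (p ∷₀ xs)) ℚ.+ down (λ ys → up≤ b g (x ∷ ys)) xs) ℚ.+ W (g (x ∷ xs))
    ≡⟨ ≡.cong (ℚ._+ W (g (x ∷ xs))) (down-∷ (up≤ b g) x xs) ⟨
  down (up≤ b g) (x ∷ xs) ℚ.+ W (g (x ∷ xs)) ∎
  where
  open ≡.≡-Reasoning
  x : ℕ
  x = suc p
  W : ℚ → ℚ
  W = when (suc x ℕₚ.≤? b)
  gₚ gₓ gₛₓ : List ℕ → ℚ
  gₚ  ys = g (p ∷₀ ys)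
  gₓ  ys = g (x ∷ ys)
  gₛₓ ys = g (suc x ∷ ys)

  lowered : ∀ {p xs} → IsPartition (suc p ∷ xs) → suc p ≤ b → headOr0 xs < suc p →
    g (suc p ∷ xs) ℚ.+ up≤ p (λ ys → g (p ∷₀ ys)) xs ≡ up≤ b g (p ∷₀ xs)
  lowered {zero}  {xs} x! 1≤b h<1 rewrite head<1⇒[] (tail! x!) h<1 =
    ≡.trans (ℚₚ.+-identityʳ _) (≡.sym (≡.trans (up≤-[] b g) (when-yes (1 ℕₚ.≤? b) 1≤b)))
  lowered {suc p} {xs} x! x≤b h<x = ≡.sym (≡.trans (up≤-∷ g xs (ℕₚ.≤-trans (ℕₚ.n≤1+n _) x≤b))
    (≡.cong (ℚ._+ _) (when-yes (suc (suc p) ℕₚ.≤? b) x≤b)))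

  -- After a box is removed from the first row, the next one either goes back there or goes below
  -- the shortened row. If the first row has no removable box, the second row is already longer than
  -- `p`, and `up≤-full` makes the left side 0 too.
  first : when (headOr0 xs ℕₚ.<? x) (g (x ∷ xs)) ℚ.+ up≤ p gₚ xs
        ≡ when (headOr0 xs ℕₚ.<? x) (up≤ b g (p ∷₀ xs))
  first with headOr0 xs ℕₚ.<? x
  ... | yes h<x = lowered x! x≤b h<x
  ... | no h≮x  = ≡.trans (ℚₚ.+-identityˡ _) (up≤-full p gₚ xs (ℕₚ.≮⇒≥ h≮x))

  rest : down (λ ys → up≤ b g (x ∷ ys)) xs ≡ W (down gₛₓ xs) ℚ.+ down (up≤ x gₓ) xs
  rest = ≡.trans (∑-congᵤ (λ ys → up≤-∷ g ys x≤b) (removeOne xs)) (≡.trans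
    (∑-+ (λ ys → W (gₛₓ ys)) (up≤ x gₓ) (removeOne xs))
    (≡.cong (ℚ._+ down (up≤ x gₓ) xs) (when-∑ (suc x ℕₚ.≤? b) (removeOne xs))))
    where
    when-∑ : ∀ (d : Dec (suc x ≤ b)) yss → ∑ (λ ys → when d (gₛₓ ys)) yss ≡ when d (∑ gₛₓ yss)
    when-∑ (yes _) yss = ≡.refl
    when-∑ (no _)  yss = ∑-0 (All.universal (λ _ → ≡.refl) yss)

-- A bound one above the first part excludes nothing, neither for `xs` itself nor after a removal,
-- so the bounded identity becomes the full one.
up-down : ∀ g {xs} → IsPartition xs → up (down g) xs ≡ down (up g) xs ℚ.+ g xs
up-down g {xs} xs! = begin
  up (down g) xs
    ≡⟨ up≡up≤ (down g) xs ℕₚ.≤-refl ⟩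
  up≤ b (down g) xs
    ≡⟨ up≤-down b g xs! (ℕₚ.n≤1+n _) ⟩
  down (up≤ b g) xs ℚ.+ when (headOr0 xs ℕₚ.<? b) (g xs)
    ≡⟨ ≡.cong₂ ℚ._+_
         (∑-cong (All.map (λ {ys} h≤ → ≡.sym (up≡up≤ g ys (s≤s h≤))) (removeOne-head xs)))
         (when-yes (headOr0 xs ℕₚ.<? b) ℕₚ.≤-refl) ⟩
  down (up g) xs ℚ.+ g xs ∎
  where
  open ≡.≡-Reasoning
  b : ℕ
  b = suc (headOr0 xs)

-- Difference operators

infix 4 _≗ₚ_
-- The commutation relation is available on partitions only. Equality there is respected by all the
-- operators because adding and removing boxes preserves partitions.
_≗ₚ_ : (g h : List ℕ → ℚ) → Set
g ≗ₚ h = ∀ {xs} → IsPartition xs → g xs ≡ h xs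

up-cong : ∀ {g h} → g ≗ₚ h → up g ≗ₚ up h
up-cong g≗h xs! = ∑-cong (All.map g≗h (addOne-partition xs!))

down-cong : ∀ {g h} → g ≗ₚ h → down g ≗ₚ down h
down-cong g≗h xs! = ∑-cong (All.map g≗h (removeOne-partition xs!))

D-cong : ∀ {g h} → g ≗ₚ h → D g ≗ₚ D h
D-cong g≗h xs! = ≡.cong₂ ℚ._-_ (up-cong g≗h xs!) (g≗h xs!)

D-+ : ∀ g h xs → D (λ ys → g ys ℚ.+ h ys) xs ≡ D g xs ℚ.+ D h xs
D-+ g h xs = ≡.trans (≡.cong (ℚ._- (g xs ℚ.+ h xs)) (∑-+ g h (addOne xs)))
  (solve 4 (λ a b c d → (a ⊹ b) ⊟ (c ⊹ d) := (a ⊟ c) ⊹ (b ⊟ d)) ≡.refl (up g xs) (up h xs) (g xs) (h xs))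

D-* : ∀ a g xs → D (λ ys → a ℚ.* g ys) xs ≡ a ℚ.* D g xs
D-* a g xs = ≡.trans (≡.cong (ℚ._- (a ℚ.* g xs)) (∑-* a g (addOne xs)))
  (solve 3 (λ a b c → a ⊠ b ⊟ a ⊠ c := a ⊠ (b ⊟ c)) ≡.refl a (up g xs) (g xs))

D-0 : D (λ _ → 0ℚ) ≗ₚ (λ _ → 0ℚ)
D-0 {xs} _ = ≡.cong (ℚ._- 0ℚ) (∑-0 (All.universal (λ _ → ≡.refl) (addOne xs)))

D-down : ∀ g → D (down g) ≗ₚ (λ xs → down (D g) xs ℚ.+ g xs)
D-down g {xs} xs! = begin
  up (down g) xs ℚ.- down g xs
    ≡⟨ ≡.cong (ℚ._- down g xs) (up-down g xs!) ⟩
  (down (up g) xs ℚ.+ g xs) ℚ.- down g xs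
    ≡⟨ solve 3 (λ u g d → (u ⊹ g) ⊟ d := (u ⊹ con (ℚ.- 1ℚ) ⊠ d) ⊹ g) ≡.refl (down (up g) xs) (g xs) (down g xs) ⟩
  (down (up g) xs ℚ.+ ℚ.- 1ℚ ℚ.* down g xs) ℚ.+ g xs
    ≡⟨ ≡.cong (λ d → (down (up g) xs ℚ.+ d) ℚ.+ g xs) (∑-* (ℚ.- 1ℚ) g (removeOne xs)) ⟨
  (down (up g) xs ℚ.+ down (λ ys → ℚ.- 1ℚ ℚ.* g ys) xs) ℚ.+ g xs
    ≡⟨ ≡.cong (ℚ._+ g xs) (∑-+ (up g) (λ ys → ℚ.- 1ℚ ℚ.* g ys) (removeOne xs)) ⟨
  down (λ ys → up g ys ℚ.+ ℚ.- 1ℚ ℚ.* g ys) xs ℚ.+ g xs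
    ≡⟨ ≡.cong (ℚ._+ g xs) (∑-congᵤ (λ ys → solve 2 (λ u g → u ⊹ con (ℚ.- 1ℚ) ⊠ g := u ⊟ g) ≡.refl
         (up g ys) (g ys)) (removeOne xs)) ⟩
  down (D g) xs ℚ.+ g xs ∎
  where open ≡.≡-Reasoning

Dpow-cong : ∀ k {g h} → g ≗ₚ h → Dpow k g ≗ₚ Dpow k h
Dpow-cong zero    g≗h = g≗h
Dpow-cong (suc k) g≗h = D-cong (Dpow-cong k g≗h)

Dpow-+ : ∀ k g h → Dpow k (λ ys → g ys ℚ.+ h ys) ≗ₚ (λ xs → Dpow k g xs ℚ.+ Dpow k h xs)
Dpow-+ zero    g h xs! = ≡.refl
Dpow-+ (suc k) g h {xs} xs! = ≡.trans (D-cong (Dpow-+ k g h) xs!) (D-+ (Dpow k g) (Dpow k h) xs)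

Dpow-* : ∀ k a g → Dpow k (λ ys → a ℚ.* g ys) ≗ₚ (λ xs → a ℚ.* Dpow k g xs)
Dpow-* zero    a g xs! = ≡.refl
Dpow-* (suc k) a g {xs} xs! = ≡.trans (D-cong (Dpow-* k a g) xs!) (D-* a (Dpow k g) xs)

Dpow-0 : ∀ k → Dpow k (λ _ → 0ℚ) ≗ₚ (λ _ → 0ℚ)
Dpow-0 zero    xs! = ≡.refl
Dpow-0 (suc k) xs! = ≡.trans (D-cong (Dpow-0 k) xs!) (D-0 xs!)

Dpow-suc : ∀ k g → Dpow (suc k) g ≡ Dpow k (D g)
Dpow-suc zero    g = ≡.refl
Dpow-suc (suc k) g = ≡.cong D (Dpow-suc k g)

downPow : ℕ → (List ℕ → ℚ) → List ℕ → ℚ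
downPow zero    g = g
downPow (suc j) g = down (downPow j g)

-- Here `g r` stands for the coefficient of zʳ in G, and the hypotheses are (U - 1) G = z V G read
-- off coefficient by coefficient.
module _ (g : ℕ → List ℕ → ℚ) (D-g₀ : D (g 0) ≗ₚ (λ _ → 0ℚ))
         (D-gₛ : ∀ r → D (g (suc r)) ≗ₚ down (g r)) where

  -- This is the coefficient of zʳ in z Vʲ⁺¹ G.
  lowered : ℕ → ℕ → List ℕ → ℚ
  lowered j zero    = λ _ → 0ℚ
  lowered j (suc r) = downPow (suc j) (g r)

  -- Commuting D past one V leaves one extra term, which increases the coefficient `fromℕ j` by one.
  -- At `j = 0` the meaningless `pred j` is multiplied by 0.
  D-downPow : ∀ j r → D (downPow j (g r)) ≗ₚ
    (λ xs → lowered j r xs ℚ.+ fromℕ j ℚ.* downPow (pred j) (g r) xs)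
  D-downPow zero zero    {xs} xs! = ≡.trans (D-g₀ xs!) (≡.sym (≡.trans (ℚₚ.+-identityˡ _) (ℚₚ.*-zeroˡ (g 0 xs))))
  D-downPow zero (suc r) {xs} xs! = ≡.trans (D-gₛ r xs!)
    (≡.sym (≡.trans (≡.cong (down (g r) xs ℚ.+_) (ℚₚ.*-zeroˡ (g (suc r) xs))) (ℚₚ.+-identityʳ _)))
  D-downPow (suc j) r {xs} xs! = begin
    D (down (downPow j (g r))) xs
      ≡⟨ D-down (downPow j (g r)) xs! ⟩
    down (D (downPow j (g r))) xs ℚ.+ v
      ≡⟨ ≡.cong (ℚ._+ v) (down-cong (D-downPow j r) xs!) ⟩
    down (λ ys → lowered j r ys ℚ.+ fromℕ j ℚ.* downPow (pred j) (g r) ys) xs ℚ.+ v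
      ≡⟨ ≡.cong (ℚ._+ v) (≡.trans (∑-+ (lowered j r) _ (removeOne xs))
           (≡.cong₂ ℚ._+_ (down-lowered r) (≡.trans (∑-* (fromℕ j) _ (removeOne xs)) (down-pred j)))) ⟩
    (lowered (suc j) r xs ℚ.+ fromℕ j ℚ.* v) ℚ.+ v
      ≡⟨ solve 3 (λ l n v → (l ⊹ n ⊠ v) ⊹ v := l ⊹ (con 1ℚ ⊹ n) ⊠ v) ≡.refl (lowered (suc j) r xs) (fromℕ j) v ⟩
    lowered (suc j) r xs ℚ.+ (1ℚ ℚ.+ fromℕ j) ℚ.* v
      ≡⟨ ≡.cong (λ n → lowered (suc j) r xs ℚ.+ n ℚ.* v) (fromℕ-+ 1 j) ⟨
    lowered (suc j) r xs ℚ.+ fromℕ (suc j) ℚ.* v ∎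
    where
    open ≡.≡-Reasoning
    v : ℚ
    v = downPow j (g r) xs
    down-lowered : ∀ r → down (lowered j r) xs ≡ lowered (suc j) r xs
    down-lowered zero    = ∑-0 (All.universal (λ _ → ≡.refl) (removeOne xs))
    down-lowered (suc r) = ≡.refl
    down-pred : ∀ j → fromℕ j ℚ.* down (downPow (pred j) (g r)) xs ≡ fromℕ j ℚ.* downPow j (g r) xs
    down-pred zero    = ≡.trans (ℚₚ.*-zeroˡ (down (g r) xs)) (≡.sym (ℚₚ.*-zeroˡ (g r xs)))
    down-pred (suc j) = ≡.refl

  -- The quantity 2r + j drops by exactly one in both terms of `D-downPow`: either r falls while j
  -- rises, or j falls alone. When no further drop is possible, the term is 0.
  Dpow-downPow-vanishes : ∀ k j r → 2 ℕ.* r ℕ.+ j < k → Dpow k (downPow j (g r)) ≗ₚ (λ _ → 0ℚ)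
  Dpow-downPow-vanishes (suc k) j r (s≤s 2r+j≤k) {xs} xs! = begin
    Dpow (suc k) (downPow j (g r)) xs
      ≡⟨ ≡.cong (λ h → h xs) (Dpow-suc k (downPow j (g r))) ⟩
    Dpow k (D (downPow j (g r))) xs
      ≡⟨ Dpow-cong k (D-downPow j r) xs! ⟩
    Dpow k (λ ys → lowered j r ys ℚ.+ fromℕ j ℚ.* downPow (pred j) (g r) ys) xs
      ≡⟨ Dpow-+ k (lowered j r) _ xs! ⟩
    Dpow k (lowered j r) xs ℚ.+ Dpow k (λ ys → fromℕ j ℚ.* downPow (pred j) (g r) ys) xs
      ≡⟨ ≡.cong₂ ℚ._+_ (lowered-vanishes r 2r+j≤k) (≡.trans (Dpow-* k (fromℕ j) _ xs!) (pred-vanishes j 2r+j≤k)) ⟩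
    0ℚ ℚ.+ 0ℚ
      ≡⟨ ℚₚ.+-identityˡ 0ℚ ⟩
    0ℚ ∎
    where
    open ≡.≡-Reasoning
    lowered-vanishes : ∀ r → 2 ℕ.* r ℕ.+ j ≤ k → Dpow k (lowered j r) xs ≡ 0ℚ
    lowered-vanishes zero    _      = Dpow-0 k xs!
    lowered-vanishes (suc r) 2r+j≤k = Dpow-downPow-vanishes k (suc j) r
      (≡.subst (_≤ k) (≡.trans (≡.cong (ℕ._+ j) (≡.cong suc (ℕₚ.+-suc r (r ℕ.+ 0))))
        (≡.sym (≡.cong suc (ℕₚ.+-suc (2 ℕ.* r) j)))) 2r+j≤k) xs!
    pred-vanishes : ∀ j → 2 ℕ.* r ℕ.+ j ≤ k → fromℕ j ℚ.* Dpow k (downPow (pred j) (g r)) xs ≡ 0ℚ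
    pred-vanishes zero    _      = ℚₚ.*-zeroˡ (Dpow k (g r) xs)
    pred-vanishes (suc j) 2r+j≤k = ≡.trans
      (≡.cong (fromℕ (suc j) ℚ.*_) (Dpow-downPow-vanishes k j r
        (≡.subst (_≤ k) (ℕₚ.+-suc (2 ℕ.* r) j) 2r+j≤k) xs!))
      (ℚₚ.*-zeroʳ (fromℕ (suc j)))

-- Binomial expansion of (1 + D)ⁿ.

sumTo-last : ∀ k g → sumTo (suc k) g ≡ sumTo k g ℚ.+ g (suc k)
sumTo-last zero    g = solve 2 (λ a b → a ⊹ (b ⊹ con 0ℚ) := (a ⊹ con 0ℚ) ⊹ b) ≡.refl (g 0) (g 1)
sumTo-last (suc k) g = begin
  sumTo (suc (suc k)) g                              ≡⟨ sumTo-suc (suc k) g ⟩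
  g 0 ℚ.+ sumTo (suc k) (λ i → g (suc i))            ≡⟨ ≡.cong (g 0 ℚ.+_) (sumTo-last k (λ i → g (suc i))) ⟩
  g 0 ℚ.+ (sumTo k (λ i → g (suc i)) ℚ.+ g (suc (suc k)))  ≡⟨ ℚₚ.+-assoc (g 0) _ (g (suc (suc k))) ⟨
  (g 0 ℚ.+ sumTo k (λ i → g (suc i))) ℚ.+ g (suc (suc k))  ≡⟨ ≡.cong (ℚ._+ g (suc (suc k))) (sumTo-suc k g) ⟨
  sumTo (suc k) g ℚ.+ g (suc (suc k))                ∎
  where open ≡.≡-Reasoning

binomial-first : ∀ k (d : ℕ → ℚ) → sumTo k (λ i → fromℕ (0 C i) ℚ.* d i) ≡ d 0
binomial-first zero    d = ≡.trans (ℚₚ.+-identityʳ _) (ℚₚ.*-identityˡ (d 0))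
binomial-first (suc k) d = ≡.trans (sumTo-last k (λ i → fromℕ (0 C i) ℚ.* d i)) (≡.trans
  (≡.cong₂ ℚ._+_ (binomial-first k d) (ℚₚ.*-zeroˡ (d (suc k)))) (ℚₚ.+-identityʳ (d 0)))

-- Truncating the sum at `k` leaves one unmatched term of Pascal's rule. For `d` the iterated
-- differences, it contains the difference of order k + 1, and vanishes in the application.
binomial-pascal : ∀ n k (d : ℕ → ℚ) →
  sumTo k (λ i → fromℕ (suc n C i) ℚ.* d i) ℚ.+ fromℕ (n C k) ℚ.* d (suc k) ≡
  sumTo k (λ i → fromℕ (n C i) ℚ.* (d (suc i) ℚ.+ d i))
binomial-pascal n zero    d =
  solve 2 (λ a b → (con 1ℚ ⊠ a ⊹ con 0ℚ) ⊹ con 1ℚ ⊠ b := con 1ℚ ⊠ (b ⊹ a) ⊹ con 0ℚ) ≡.refl (d 0) (d 1)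
binomial-pascal n (suc k) d = begin
  sumTo (suc k) (λ i → fromℕ (suc n C i) ℚ.* d i) ℚ.+ b ℚ.* d (suc (suc k))
    ≡⟨ ≡.cong (ℚ._+ b ℚ.* d (suc (suc k))) (sumTo-last k (λ i → fromℕ (suc n C i) ℚ.* d i)) ⟩
  (S ℚ.+ fromℕ (suc n C suc k) ℚ.* d (suc k)) ℚ.+ b ℚ.* d (suc (suc k))
    ≡⟨ ≡.cong (λ c → (S ℚ.+ c ℚ.* d (suc k)) ℚ.+ b ℚ.* d (suc (suc k)))
         (≡.trans (≡.cong fromℕ (≡.sym (nCk+nC[k+1]≡[n+1]C[k+1] n k))) (fromℕ-+ (n C k) (n C suc k))) ⟩
  (S ℚ.+ (a ℚ.+ b) ℚ.* d (suc k)) ℚ.+ b ℚ.* d (suc (suc k))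
    ≡⟨ solve 5 (λ s a b d e → (s ⊹ (a ⊹ b) ⊠ d) ⊹ b ⊠ e := (s ⊹ a ⊠ d) ⊹ b ⊠ (e ⊹ d)) ≡.refl
         S a b (d (suc k)) (d (suc (suc k))) ⟩
  (S ℚ.+ a ℚ.* d (suc k)) ℚ.+ b ℚ.* (d (suc (suc k)) ℚ.+ d (suc k))
    ≡⟨ ≡.cong (ℚ._+ b ℚ.* (d (suc (suc k)) ℚ.+ d (suc k))) (binomial-pascal n k d) ⟩
  sumTo k (λ i → fromℕ (n C i) ℚ.* (d (suc i) ℚ.+ d i)) ℚ.+ b ℚ.* (d (suc (suc k)) ℚ.+ d (suc k))
    ≡⟨ sumTo-last k (λ i → fromℕ (n C i) ℚ.* (d (suc i) ℚ.+ d i)) ⟨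
  sumTo (suc k) (λ i → fromℕ (n C i) ℚ.* (d (suc i) ℚ.+ d i)) ∎
  where
  open ≡.≡-Reasoning
  S a b : ℚ
  S = sumTo k (λ i → fromℕ (suc n C i) ℚ.* d i)
  a = fromℕ (n C k)
  b = fromℕ (n C suc k)

upPow : ℕ → (List ℕ → ℚ) → List ℕ → ℚ
upPow zero    g = g
upPow (suc n) g = up (upPow n g)

upPow-binomial : ∀ {g} m → Dpow (suc m) g ≗ₚ (λ _ → 0ℚ) → ∀ n →
  upPow n g ≗ₚ (λ xs → sumTo m (λ k → fromℕ (n C k) ℚ.* Dpow k g xs))
upPow-binomial {g} m D≗0 zero    {xs} xs! = ≡.sym (binomial-first m (λ k → Dpow k g xs))
upPow-binomial {g} m D≗0 (suc n) {xs} xs! = begin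
  up (upPow n g) xs
    ≡⟨ up-cong (upPow-binomial m D≗0 n) xs! ⟩
  ∑ (λ ys → ∑ (λ k → fromℕ (n C k) ℚ.* Dpow k g ys) (upTo (suc m))) (addOne xs)
    ≡⟨ ∑-swap (λ ys k → fromℕ (n C k) ℚ.* Dpow k g ys) (addOne xs) (upTo (suc m)) ⟩
  sumTo m (λ k → up (λ ys → fromℕ (n C k) ℚ.* Dpow k g ys) xs)
    ≡⟨ sumTo-cong m (λ {k} _ → ≡.trans (∑-* (fromℕ (n C k)) (Dpow k g) (addOne xs))
         (≡.cong (fromℕ (n C k) ℚ.*_) (solve 2 (λ u d → u := (u ⊟ d) ⊹ d) ≡.refl (up (Dpow k g) xs) (Dpow k g xs)))) ⟩
  sumTo m (λ k → fromℕ (n C k) ℚ.* (Dpow (suc k) g xs ℚ.+ Dpow k g xs))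
    ≡⟨ binomial-pascal n m (λ k → Dpow k g xs) ⟨
  S ℚ.+ fromℕ (n C m) ℚ.* Dpow (suc m) g xs
    ≡⟨ ≡.cong (S ℚ.+_) (≡.trans (≡.cong (fromℕ (n C m) ℚ.*_) (D≗0 xs!)) (ℚₚ.*-zeroʳ (fromℕ (n C m)))) ⟩
  S ℚ.+ 0ℚ
    ≡⟨ ℚₚ.+-identityʳ S ⟩
  S ∎
  where
  open ≡.≡-Reasoning
  S : ℚ
  S = sumTo m (λ k → fromℕ (suc n C k) ℚ.* Dpow k g xs)

-- Sums over skew shapes

chains₀-diagonal : ∀ xs → chains 0 xs xs ≡ 1
chains₀-diagonal xs with ≡-dec ℕₚ._≟_ xs xs
... | yes _    = ≡.refl
... | no xs≢xs = contradiction ≡.refl xs≢xs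

chains₀-≢ : ∀ {xs ys} → xs ≢ ys → chains 0 xs ys ≡ 0
chains₀-≢ {xs} {ys} xs≢ys with ≡-dec ℕₚ._≟_ xs ys
... | yes xs≡ys = contradiction xs≡ys xs≢ys
... | no _      = ≡.refl

chains₀-∷ : ∀ x xs ys → chains 0 (x ∷ xs) (x ∷ ys) ≡ chains 0 xs ys
chains₀-∷ x xs ys = by-cases (≡-dec ℕₚ._≟_ xs ys)
  where
  by-cases : Dec (xs ≡ ys) → chains 0 (x ∷ xs) (x ∷ ys) ≡ chains 0 xs ys
  by-cases (yes ≡.refl) = ≡.trans (chains₀-diagonal (x ∷ xs)) (≡.sym (chains₀-diagonal xs))
  by-cases (no xs≢ys)   = ≡.trans (chains₀-≢ (λ eq → xs≢ys (∷-injectiveʳ eq))) (≡.sym (chains₀-≢ xs≢ys))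

size≡0⇒[] : ∀ {xs} → IsPartition xs → size xs ≡ 0 → xs ≡ []
size≡0⇒[] {[]}     _  _  = ≡.refl
size≡0⇒[] {x ∷ xs} x! eq = contradiction (ℕₚ.m+n≡0⇒m≡0 x eq) (ℕₚ.>⇒≢ (head-pos x!))

∑-singleton-[] : ∀ (g : List ℕ → ℚ) → ∑ (λ ys → fromℕ (chains 0 [] ys) ℚ.* g ys) ([] ∷ []) ≡ g []
∑-singleton-[] g = ≡.trans (ℚₚ.+-identityʳ _) (ℚₚ.*-identityˡ (g []))

-- Here `chains 0 xs` is a Kronecker delta. Summing it against an arbitrary `g` expresses that the
-- enumeration lists `xs` exactly once, in the form that the sums over shapes require.
partsBounded-once : ∀ fuel m b → m ≤ fuel → ∀ {xs} → IsPartition xs → headOr0 xs ≤ b → size xs ≡ m →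
  ∀ (g : List ℕ → ℚ) → ∑ (λ ys → fromℕ (chains 0 xs ys) ℚ.* g ys) (partsBounded fuel m b) ≡ g xs
partsBounded-once zero    zero    b _ xs! _ size≡0 g rewrite size≡0⇒[] xs! size≡0 = ∑-singleton-[] g
partsBounded-once (suc f) zero    b _ xs! _ size≡0 g rewrite size≡0⇒[] xs! size≡0 = ∑-singleton-[] g
partsBounded-once (suc f) (suc m) b (s≤s m≤f) {suc x ∷ xs} x! x≤b size≡m g = begin
  ∑ δg (concatMap block (applyUpTo suc (suc m ℕ.⊓ b)))
    ≡⟨ ∑-concatMap δg block (applyUpTo suc (suc m ℕ.⊓ b)) ⟩
  ∑ (λ p → ∑ δg (block p)) (applyUpTo suc (suc m ℕ.⊓ b))
    ≡⟨ ∑-applyUpTo (λ p → ∑ δg (block p)) suc {x} (ℕₚ.⊓-glb x≤m x≤b) other-blocks ⟩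
  ∑ δg (map (suc x ∷_) (partsBounded f (m ∸ x) (suc x)))
    ≡⟨ ∑-map δg (suc x ∷_) (partsBounded f (m ∸ x) (suc x)) ⟩
  ∑ (λ ys → fromℕ (chains 0 (suc x ∷ xs) (suc x ∷ ys)) ℚ.* g (suc x ∷ ys)) (partsBounded f (m ∸ x) (suc x))
    ≡⟨ ∑-congᵤ (λ ys → ≡.cong (λ n → fromℕ n ℚ.* g (suc x ∷ ys)) (chains₀-∷ (suc x) xs ys))
         (partsBounded f (m ∸ x) (suc x)) ⟩
  ∑ (λ ys → fromℕ (chains 0 xs ys) ℚ.* g (suc x ∷ ys)) (partsBounded f (m ∸ x) (suc x))
    ≡⟨ partsBounded-once f (m ∸ x) (suc x) (ℕₚ.≤-trans (ℕₚ.m∸n≤m m x) m≤f) (tail! x!) (head! x!)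
         (≡.trans (≡.sym (ℕₚ.m+n∸m≡n x (size xs))) (≡.cong (_∸ x) (ℕₚ.suc-injective size≡m)))
         (λ ys → g (suc x ∷ ys)) ⟩
  g (suc x ∷ xs) ∎
  where
  open ≡.≡-Reasoning
  δg : List ℕ → ℚ
  δg ys = fromℕ (chains 0 (suc x ∷ xs) ys) ℚ.* g ys
  block : ℕ → List (List ℕ)
  block p = map (p ∷_) (partsBounded f (suc m ∸ p) p)
  x≤m : suc x ≤ suc m
  x≤m = ≡.subst (suc x ≤_) size≡m (ℕₚ.m≤m+n (suc x) (size xs))
  other-blocks : ∀ i → i ≢ x → ∑ δg (block (suc i)) ≡ 0ℚ
  other-blocks i i≢x = ∑-0 (Allₚ.map⁺ (All.universal (λ ys →
    ≡.trans (≡.cong (λ n → fromℕ n ℚ.* g (suc i ∷ ys))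
              (chains₀-≢ (λ eq → i≢x (≡.sym (ℕₚ.suc-injective (∷-injectiveˡ eq))))))
            (ℚₚ.*-zeroˡ (g (suc i ∷ ys)))) (partsBounded f (m ∸ i) (suc i))))
partsBounded-once (suc f) (suc m) b _ {zero ∷ xs} x! = contradiction (head-pos x!) ℕₚ.n≮0

partsBounded-size : ∀ fuel m b → m ≤ fuel → All (λ ys → size ys ≡ m) (partsBounded fuel m b)
partsBounded-size zero    zero    b _         = ≡.refl ∷ []
partsBounded-size (suc f) zero    b _         = ≡.refl ∷ []
partsBounded-size (suc f) (suc m) b (s≤s m≤f) = Allₚ.concat⁺ (Allₚ.map⁺ (Allₚ.applyUpTo⁺₁ suc (suc m ℕ.⊓ b)
  (λ {i} i< → Allₚ.map⁺ (All.map
    (λ eq → ≡.cong suc (≡.trans (≡.cong (i ℕ.+_) eq)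
      (ℕₚ.m+[n∸m]≡n (ℕₚ.≤-pred (ℕₚ.≤-trans i< (ℕₚ.m⊓n≤m (suc m) b))))))
    (partsBounded-size f (m ∸ i) (suc i) (ℕₚ.≤-trans (ℕₚ.m∸n≤m m i) m≤f))))))

∧-true : ∀ {a b} → T (a ∧ b) → T a × T b
∧-true {true} {true} _ = _ , _

true-∧ : ∀ {a b} → T a → T b → T (a ∧ b)
true-∧ {true} _ b = b

contains-refl : ∀ xs → T (contains xs xs)
contains-refl []       = _
contains-refl (x ∷ xs) = true-∧ (ℕₚ.≤⇒≤ᵇ (ℕₚ.≤-refl {x})) (contains-refl xs)

contains-trans : ∀ xs ys zs → T (contains xs ys) → T (contains ys zs) → T (contains xs zs)
contains-trans xs       ys       []       _     _     = _
contains-trans (x ∷ xs) (y ∷ ys) (z ∷ zs) xs⊇ys ys⊇zs with ∧-true {y ℕ.≤ᵇ x} xs⊇ys | ∧-true {z ℕ.≤ᵇ y} ys⊇zs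
... | y≤x , xs⊇ys′ | z≤y , ys⊇zs′ =
  true-∧ (ℕₚ.≤⇒≤ᵇ (ℕₚ.≤-trans (ℕₚ.≤ᵇ⇒≤ z y z≤y) (ℕₚ.≤ᵇ⇒≤ y x y≤x))) (contains-trans xs ys zs xs⊇ys′ ys⊇zs′)

addOne-contains : ∀ xs → All (λ ys → T (contains ys xs)) (addOne xs)
addOne-contains []       = _ ∷ []
addOne-contains (x ∷ xs) =
  true-∧ (ℕₚ.≤⇒≤ᵇ (ℕₚ.n≤1+n x)) (contains-refl xs) ∷
  Allₚ.map⁺ (All.map (true-∧ (ℕₚ.≤⇒≤ᵇ (ℕₚ.≤-refl {x})))
    (Allₚ.filter⁺ (λ ys → headOr0 ys ℕₚ.≤? x) (addOne-contains xs)))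

addOne-size : ∀ xs → All (λ ys → size ys ≡ suc (size xs)) (addOne xs)
addOne-size []       = ≡.refl ∷ []
addOne-size (x ∷ xs) = ≡.refl ∷
  Allₚ.map⁺ (All.map (λ eq → ≡.trans (≡.cong (x ℕ.+_) eq) (ℕₚ.+-suc x (size xs)))
    (Allₚ.filter⁺ (λ ys → headOr0 ys ℕₚ.≤? x) (addOne-size xs)))

fromℕ-sum : ∀ {x} {X : Set x} (h : X → ℕ) xs → fromℕ (sum (map h xs)) ≡ ∑ (λ x → fromℕ (h x)) xs
fromℕ-sum h []       = ≡.refl
fromℕ-sum h (x ∷ xs) = ≡.trans (fromℕ-+ (h x) (sum (map h xs))) (≡.cong (fromℕ (h x) ℚ.+_) (fromℕ-sum h xs))

∑-chains : ∀ Λ (g : List ℕ → ℚ) n {μ} → IsPartition μ →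
  (∀ {ν} → IsPartition ν → T (contains ν μ) → size ν ≡ n ℕ.+ size μ →
    ∑ (λ ys → fromℕ (chains 0 ν ys) ℚ.* g ys) Λ ≡ g ν) →
  ∑ (λ ys → fromℕ (chains n μ ys) ℚ.* g ys) Λ ≡ upPow n g μ
∑-chains Λ g zero    {μ} μ! once = once μ! (contains-refl μ) ≡.refl
∑-chains Λ g (suc n) {μ} μ! once = begin
  ∑ (λ ys → fromℕ (sum (map (λ ν → chains n ν ys) (addOne μ))) ℚ.* g ys) Λ
    ≡⟨ ∑-congᵤ (λ ys → ≡.trans (≡.cong (ℚ._* g ys) (fromℕ-sum (λ ν → chains n ν ys) (addOne μ)))
         (≡.trans (ℚₚ.*-comm _ (g ys)) (≡.trans (≡.sym (∑-* (g ys) _ (addOne μ)))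
           (∑-congᵤ (λ ν → ℚₚ.*-comm (g ys) (fromℕ (chains n ν ys))) (addOne μ))))) Λ ⟩
  ∑ (λ ys → ∑ (λ ν → fromℕ (chains n ν ys) ℚ.* g ys) (addOne μ)) Λ
    ≡⟨ ∑-swap (λ ys ν → fromℕ (chains n ν ys) ℚ.* g ys) Λ (addOne μ) ⟩
  ∑ (λ ν → ∑ (λ ys → fromℕ (chains n ν ys) ℚ.* g ys) Λ) (addOne μ)
    ≡⟨ ∑-cong (All.zipWith (λ { {ν} (ν! , ν⊇μ , size≡) → ∑-chains Λ g n ν! (λ {κ} κ! κ⊇ν eq →
         once κ! (contains-trans κ ν μ κ⊇ν ν⊇μ)
           (≡.trans eq (≡.trans (≡.cong (n ℕ.+_) size≡) (ℕₚ.+-suc n (size μ))))) })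
         (addOne-partition μ! , All.zip (addOne-contains μ , addOne-size μ))) ⟩
  upPow (suc n) g μ ∎
  where open ≡.≡-Reasoning

headOr0≤size : ∀ xs → headOr0 xs ≤ size xs
headOr0≤size []       = z≤n
headOr0≤size (x ∷ xs) = ℕₚ.m≤m+n x (size xs)

skewShapes-once : ∀ μ n (g : List ℕ → ℚ) {ν} → IsPartition ν → T (contains ν μ) → size ν ≡ n ℕ.+ size μ →
  ∑ (λ ys → fromℕ (chains 0 ν ys) ℚ.* g ys) (skewShapes μ n) ≡ g ν
skewShapes-once μ n g {ν} ν! ν⊇μ size≡ = ≡.trans
  (∑-filter (λ ys → T? (contains ys μ)) (All.universal relevant (partitionsOf N)))
  (partsBounded-once N N N ℕₚ.≤-refl ν! (≡.subst (headOr0 ν ≤_) size≡N (headOr0≤size ν)) size≡N g)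
  where
  N : ℕ
  N = size μ ℕ.+ n
  size≡N : size ν ≡ N
  size≡N = ≡.trans size≡ (ℕₚ.+-comm n (size μ))
  relevant : ∀ ys → T (contains ys μ) ⊎ fromℕ (chains 0 ν ys) ℚ.* g ys ≡ 0ℚ
  relevant ys = by-cases (≡-dec ℕₚ._≟_ ν ys)
    where
    by-cases : Dec (ν ≡ ys) → T (contains ys μ) ⊎ fromℕ (chains 0 ν ys) ℚ.* g ys ≡ 0ℚ
    by-cases (yes ≡.refl) = inj₁ ν⊇μ
    by-cases (no ν≢ys)    = inj₂ (≡.trans (≡.cong (λ k → fromℕ k ℚ.* g ys) (chains₀-≢ ν≢ys))
                                          (ℚₚ.*-zeroˡ (g ys)))

∑-skewShapes : ∀ {μ} → IsPartition μ → ∀ n (g : List ℕ → ℚ) →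
  ∑ (λ ys → fromℕ (fSkew ys μ) ℚ.* g ys) (skewShapes μ n) ≡ upPow n g μ
∑-skewShapes {μ} μ! n g = ≡.trans
  (∑-cong (All.map (λ {ys} size≡ → ≡.cong (λ k → fromℕ (chains k μ ys) ℚ.* g ys)
      (≡.trans (≡.cong (_∸ size μ) size≡) (ℕₚ.m+n∸m≡n (size μ) n)))
    (Allₚ.filter⁺ (λ ys → T? (contains ys μ))
      (partsBounded-size (size μ ℕ.+ n) (size μ ℕ.+ n) (size μ ℕ.+ n) ℕₚ.≤-refl))))
  (∑-chains (skewShapes μ n) g n μ! (skewShapes-once μ n g))

skewShapes-[] : ∀ n → skewShapes [] n ≡ partitionsOf n
skewShapes-[] n = filter-all (λ ys → T? (contains ys [])) (All.universal (λ _ → _) (partitionsOf n))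

-- Identification of the coefficients of the hook product.

ρ≡h*φₛ : ∀ {h} → 0 < h → ∀ k → ρ h k ≡ fromℕ h ℚ.* φₛ h k
ρ≡h*φₛ {h} 0<h k = ≡.sym (≡.trans (≡.sym (ℚₚ.*-assoc (fromℕ h) (recip h) (ρ h k)))
  (≡.trans (≡.cong (ℚ._* ρ h k) (fromℕ*recip 0<h)) (ℚₚ.*-identityˡ (ρ h k))))

∏ρ≡∏h*∏φₛ : ∀ {hs} → All (0 <_) hs → ∀ k →
  foldr _*ₛ_ oneₛ (map ρ hs) k ≡ fromℕ (product hs) ℚ.* foldr _⊛_ oneₛ (map φₛ hs) k
∏ρ≡∏h*∏φₛ {[]}     []           k = ≡.sym (ℚₚ.*-identityˡ (oneₛ k))
∏ρ≡∏h*∏φₛ {h ∷ hs} (0<h ∷ 0<hs) k = begin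
  (ρ h *ₛ foldr _*ₛ_ oneₛ (map ρ hs)) k
    ≡⟨ *ₛ≡⊛ (ρ h) _ k ⟩
  (ρ h ⊛ foldr _*ₛ_ oneₛ (map ρ hs)) k
    ≡⟨ ⊛-cong (ρ≡h*φₛ 0<h) (∏ρ≡∏h*∏φₛ 0<hs) k ⟩
  ((λ i → fromℕ h ℚ.* φₛ h i) ⊛ (λ i → P ℚ.* B i)) k
    ≡⟨ ⊛-scaleˡ (fromℕ h) (φₛ h) (λ i → P ℚ.* B i) k ⟩
  fromℕ h ℚ.* (φₛ h ⊛ (λ i → P ℚ.* B i)) k
    ≡⟨ ≡.cong (fromℕ h ℚ.*_) (≡.trans (⊛-comm (φₛ h) (λ i → P ℚ.* B i) k) (≡.trans
         (⊛-scaleˡ P B (φₛ h) k) (≡.cong (P ℚ.*_) (⊛-comm B (φₛ h) k)))) ⟩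
  fromℕ h ℚ.* (P ℚ.* (φₛ h ⊛ B) k)
    ≡⟨ ℚₚ.*-assoc (fromℕ h) P ((φₛ h ⊛ B) k) ⟨
  (fromℕ h ℚ.* P) ℚ.* (φₛ h ⊛ B) k
    ≡⟨ ≡.cong (ℚ._* (φₛ h ⊛ B) k) (fromℕ-* h (product hs)) ⟨
  fromℕ (product (h ∷ hs)) ℚ.* (φₛ h ⊛ B) k ∎
  where
  open ≡.≡-Reasoning
  P : ℚ
  P = fromℕ (product hs)
  B : Series
  B = foldr _⊛_ oneₛ (map φₛ hs)

product-positive : ∀ {hs} → All (0 <_) hs → 0 < product hs
product-positive []           = s≤s z≤n
product-positive (0<h ∷ 0<hs) = ℕₚ.*-mono-≤ 0<h (product-positive 0<hs)

hooks-positive : ∀ xs → All (0 <_) (hooks xs)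
hooks-positive xs = Allₚ.map⁺ (All.universal (λ c → ℕₚ.m≤n+m 1 _) (cells xs))

LoverH-partWeight : ∀ r → LoverH r ≗ₚ (λ xs → partWeight xs r)
LoverH-partWeight r {xs} xs! = begin
  foldr _*ₛ_ oneₛ (map (λ c → ρ (hook xs c)) (cells xs)) r ℚ.* recip (H xs)
    ≡⟨ ≡.cong (λ ss → foldr _*ₛ_ oneₛ ss r ℚ.* recip (H xs)) (map-∘ (cells xs)) ⟩
  foldr _*ₛ_ oneₛ (map ρ (hooks xs)) r ℚ.* recip (H xs)
    ≡⟨ ≡.cong (ℚ._* recip (H xs)) (∏ρ≡∏h*∏φₛ (hooks-positive xs) r) ⟩
  (fromℕ (H xs) ℚ.* B) ℚ.* recip (H xs)
    ≡⟨ solve 3 (λ h b i → (h ⊠ b) ⊠ i := (h ⊠ i) ⊠ b) ≡.refl (fromℕ (H xs)) B (recip (H xs)) ⟩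
  (fromℕ (H xs) ℚ.* recip (H xs)) ℚ.* B
    ≡⟨ ≡.cong (ℚ._* B) (fromℕ*recip (product-positive (hooks-positive xs))) ⟩
  1ℚ ℚ.* B
    ≡⟨ ℚₚ.*-identityˡ B ⟩
  B
    ≡⟨ hookProduct-partWeight xs! r ⟩
  partWeight xs r ∎
  where
  open ≡.≡-Reasoning
  B : ℚ
  B = foldr _⊛_ oneₛ (map φₛ (hooks xs)) r

up-partWeight : ∀ r {xs} → IsPartition xs →
  up (λ ys → partWeight ys r) xs ≡ partWeight xs r ℚ.+ (zₛ ⊛ (λ k → down (λ ys → partWeight ys k) xs)) r
up-partWeight r {xs} xs! = ≡.trans (≡.sym (coefficient r (addOne xs)))
  (≡.trans (addOne-removeOne zₛ-cancel xs! r)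
    (≡.cong (partWeight xs r ℚ.+_) (⊛-cong {zₛ} (λ _ → ≡.refl) (λ k → coefficient k (removeOne xs)) r)))
  where
  coefficient : ∀ k yss → Sums.sumOver seriesRing partWeight yss k ≡ ∑ (λ ys → partWeight ys k) yss
  coefficient k []         = ≡.refl
  coefficient k (ys ∷ yss) = ≡.cong (partWeight ys k ℚ.+_) (coefficient k yss)

D-partWeight-0 : D (λ ys → partWeight ys 0) ≗ₚ (λ _ → 0ℚ)
D-partWeight-0 {xs} xs! = ≡.trans (≡.cong (ℚ._- partWeight xs 0) (≡.trans (up-partWeight 0 xs!)
    (≡.trans (≡.cong (partWeight xs 0 ℚ.+_) (zₛ-⊛-zero (λ k → down (λ ys → partWeight ys k) xs)))
             (ℚₚ.+-identityʳ (partWeight xs 0)))))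
  (ℚₚ.+-inverseʳ (partWeight xs 0))

D-partWeight-suc : ∀ r → D (λ ys → partWeight ys (suc r)) ≗ₚ down (λ ys → partWeight ys r)
D-partWeight-suc r {xs} xs! = ≡.trans (≡.cong (ℚ._- partWeight xs (suc r)) (≡.trans (up-partWeight (suc r) xs!)
    (≡.cong (partWeight xs (suc r) ℚ.+_) (zₛ-⊛-suc (λ k → down (λ ys → partWeight ys k) xs) r))))
  (solve 2 (λ p d → (p ⊹ d) ⊟ p := d) ≡.refl (partWeight xs (suc r)) (down (λ ys → partWeight ys r) xs))

Dpow-LoverH-vanishes : ∀ r → Dpow (suc (2 ℕ.* r)) (LoverH r) ≗ₚ (λ _ → 0ℚ)
Dpow-LoverH-vanishes r xs! = ≡.trans (Dpow-cong (suc (2 ℕ.* r)) (LoverH-partWeight r) xs!)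
  (Dpow-downPow-vanishes (λ k ys → partWeight ys k) D-partWeight-0 D-partWeight-suc
    (suc (2 ℕ.* r)) 0 r (s≤s (ℕₚ.≤-reflexive (ℕₚ.+-identityʳ (2 ℕ.* r)))) xs!)

skewSum-binomSum : ∀ {μ} → IsPartition μ → ∀ r n →
  skewSum μ r n ≡ binomSum r n (λ k → Dpow k (LoverH r) μ)
skewSum-binomSum μ! r n = ≡.trans (∑-skewShapes μ! n (LoverH r))
  (upPow-binomial (2 ℕ.* r) (Dpow-LoverH-vanishes r) n μ!)

theorem5p5 : ((μ : List ℕ) → IsPartition μ → (r n : ℕ) →
    skewSum μ r n ≡ binomSum r n (λ k → Dpow k (LoverH r) μ))
    × ((r n : ℕ) →
    straightSum r n ≡ binomSum r n (λ k → Dpow k (LoverH r) []))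
theorem5p5 = (λ μ μ! → skewSum-binomSum μ!) , (λ r n → ≡.trans
  (≡.cong (∑ (λ ys → fromℕ (f ys) ℚ.* LoverH r ys)) (≡.sym (skewShapes-[] n)))
  (skewSum-binomSum nil r n))
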